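{- Let $G$ be a (simple, finite) graph with vertex set $V(G)=\{1,\ldots,n\}$, $n\ge 4$. Let $e=\{i,j\}$ and $f=\{k,\ell\}$ be edges of $G$ with no common vertex, such that $G\setminus\{e\}$ and $G\setminus\{f\}$ are connected. Let $L$, $L_e$, $L_f$ be the Laplacian matrices of $G$, $G\setminus\{e\}$, $G\setminus\{f\}$ respectively, and let $x_e, x_f$ be the incidence vectors of $e,f$ (with respect to fixed orientations of these edges). Then the following statements are equivalent: (i) $r_G(i,j)=r_{G\setminus\{f\}}(i,j)$; (ii) $r_G(k,\ell)=r_{G\setminus\{e\}}(k,\ell)$; (iii) $\tau(G\setminus\{e\})\,\tau(G\setminus\{f\})=\tau(G)\,\tau(G\setminus\{e,f\})$; (iv) the $i$-th and $j$-th coordinates of $L^+x_f$ are equal; (v) the $i$-th and $j$-th coordinates of $L^-x_f$ are equal for any generalized inverse $L^-$ of $L$; (vi) the $i$-th and $j$-th coordinates of $L_f^+x_f$ are equal; (vii) the $i$-th and $j$-th coordinates of $L_f^-x_f$ are equal for any generalized inverse $L_f^-$ of $L_f$; (viii) the $k$-th and $\ell$-th coordinates of $L^+x_e$ are equal; (ix) the $k$-th and $\ell$-th coordinates of $L^-x_e$ are equal for any generalized inverse $L^-$ of $L$; (x) the $k$-th and $\ell$-th coordinates of $L_e^+x_e$ are equal; (xi) the $k$-th and $\ell$-th coordinates of $L_e^-x_e$ are equal for any generalized inverse $L_e^-$ of $L_e$.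
   Context: For a graph $H$ on vertices $\{1,\dots,n\}$ the Laplacian is $L=D-A$, where $A$ is the adjacency matrix and $D$ the diagonal matrix of vertex degrees. A generalized inverse of a matrix $M$ is any matrix $M^-$ with $MM^-M=M$; $M^+$ denotes the Moore–Penrose inverse. $\tau(H)$ denotes the number of spanning trees of $H$. For a connected graph $H$ with Laplacian $L$ and vertices $a,b$, the resistance distance is $r_H(a,b)=h_{aa}+h_{bb}-h_{ab}-h_{ba}$ where $H=(h_{st})$ is any generalized inverse of $L$ (this is independent of the choice; e.g. $r_H(a,b)=\ell^+_{aa}+\ell^+_{bb}-2\ell^+_{ab}$). If an edge $\{a,b\}$ is oriented from $a$ to $b$, its incidence vector is the $n\times 1$ vector with $1$ in position $a$, $-1$ in position $b$, and $0$ elsewhere.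
   Formalization: Matrices have rational entries: in (v), (vii), (ix) and (xi) "any generalized inverse" ranges over rational generalized inverses instead of real ones (the Moore–Penrose inverses and resistances are rational anyway). -}

module Defs where

open import Data.Nat using (ℕ; zero; suc; _∸_; _≡ᵇ_)
open import Data.Fin using (Fin)
import Data.Fin as F
open import Data.Bool using (Bool; true; false; _∧_; _∨_; not; if_then_else_)
open import Data.Product using (_×_; _,_)
open import Data.List using (List; []; _∷_; map; concatMap; allFin; length; filterᵇ; _++_)
open import Data.Bool.ListAction using (any; all)
open import Data.List.Membership.Propositional using (_∈_)
open import Data.Rational using (ℚ; 0ℚ; 1ℚ; _+_; _*_; _-_; -_)
open import Relation.Binary.PropositionalEquality using (_≡_)
open import Relation.Nullary.Decidable using (⌊_⌋)
open import Function.Bundles using (_⇔_)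

Adj : ℕ → Set
Adj n = Fin n → Fin n → Bool

IsSimple : ∀ {n} → Adj n → Set
IsSimple {n} A = (∀ (a b : Fin n) → A a b ≡ A b a) × (∀ (a : Fin n) → A a a ≡ false)

_==_ : ∀ {n} → Fin n → Fin n → Bool
a == b = ⌊ a F.≟ b ⌋

deleteEdge : ∀ {n} → Adj n → Fin n → Fin n → Adj n
deleteEdge A a b x y = A x y ∧ not ((x == a ∧ y == b) ∨ (x == b ∧ y == a))

data Reachable {n} (A : Adj n) : Fin n → Fin n → Set where
  here : ∀ {a} → Reachable A a a
  step : ∀ {a b c} → Reachable A a b → A b c ≡ true → Reachable A a c

Connected : ∀ {n} → Adj n → Set
Connected {n} A = ∀ (a b : Fin n) → Reachable A a b

-- Number of spanning trees τ(H).
-- Edges of H listed as pairs (a,b) with a < b; a set of edges is a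
-- sublist of this list.  A spanning tree is a set of n-1 edges whose
-- spanning subgraph is connected.

edges : ∀ {n} → Adj n → List (Fin n × Fin n)
edges {n} A = concatMap (λ a → map (λ b → (a , b))
                 (filterᵇ (λ b → ⌊ a F.<? b ⌋ ∧ A a b) (allFin n))) (allFin n)

sublists : ∀ {X : Set} → List X → List (List X)
sublists [] = [] ∷ []
sublists (x ∷ xs) = let r = sublists xs in r ++ map (x ∷_) r

edgeAdj : ∀ {n} → List (Fin n × Fin n) → Adj n
edgeAdj s c d = any (λ { (x , y) → (x == c ∧ y == d) ∨ (x == d ∧ y == c) }) s

anyFin : ∀ {n} → (Fin n → Bool) → Bool
anyFin {n} p = any p (allFin n)

allFinB : ∀ {n} → (Fin n → Bool) → Bool
allFinB {n} p = all p (allFin n)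

reach : ∀ {n} → List (Fin n × Fin n) → ℕ → Fin n → Fin n → Bool
reach s zero a b = a == b
reach s (suc k) a b = reach s k a b ∨ anyFin (λ c → reach s k a c ∧ edgeAdj s c b)

connectedᵇ : ∀ {n} → List (Fin n × Fin n) → Bool
connectedᵇ {n} s = allFinB (λ a → allFinB (λ b → reach s n a b))

isSpanningTreeᵇ : ∀ {n} → List (Fin n × Fin n) → Bool
isSpanningTreeᵇ {n} s = (length s ≡ᵇ (n ∸ 1)) ∧ connectedᵇ s

τ : ∀ {n} → Adj n → ℕ
τ A = length (filterᵇ isSpanningTreeᵇ (sublists (edges A)))

Mat : ℕ → Set
Mat n = Fin n → Fin n → ℚ

Vec : ℕ → Set
Vec n = Fin n → ℚ

sumℚ : ∀ {n} → (Fin n → ℚ) → ℚ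
sumℚ {zero} f = 0ℚ
sumℚ {suc n} f = f F.zero + sumℚ (λ i → f (F.suc i))

_⊗_ : ∀ {n} → Mat n → Mat n → Mat n
(M ⊗ N) i j = sumℚ (λ k → M i k * N k j)

_·_ : ∀ {n} → Mat n → Vec n → Vec n
(M · v) i = sumℚ (λ k → M i k * v k)

transpose : ∀ {n} → Mat n → Mat n
transpose M i j = M j i

_≐_ : ∀ {n} → Mat n → Mat n → Set
M ≐ N = ∀ i j → M i j ≡ N i j

degree : ∀ {n} → Adj n → Fin n → ℚ
degree A i = sumℚ (λ j → if A i j then 1ℚ else 0ℚ)

laplacian : ∀ {n} → Adj n → Mat n
laplacian A i j = if i == j then degree A i else (if A i j then - 1ℚ else 0ℚ)

IsGenInverse : ∀ {n} → Mat n → Mat n → Set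
IsGenInverse M X = ((M ⊗ X) ⊗ M) ≐ M

IsMoorePenrose : ∀ {n} → Mat n → Mat n → Set
IsMoorePenrose M X =
  (((M ⊗ X) ⊗ M) ≐ M) × (((X ⊗ M) ⊗ X) ≐ X)
  × (transpose (M ⊗ X) ≐ (M ⊗ X)) × (transpose (X ⊗ M) ≐ (X ⊗ M))

-- resistance distance computed from a generalized inverse X of L
resistance : ∀ {n} → Mat n → Fin n → Fin n → ℚ
resistance X a b = ((X a a + X b b) - X a b) - X b a

incidence : ∀ {n} → Fin n → Fin n → Vec n
incidence a b x = if x == a then 1ℚ else (if x == b then - 1ℚ else 0ℚ)

TFAE : List Set → Set₁
TFAE ps = ∀ {p q : Set} → p ∈ ps → q ∈ ps → (p ⇔ q)

{-# OPTIONS --safe #-}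
-- Everything is expressed through the bilinear energy form
-- ⟨v , w⟩ = Σ_{ab ∈ E} (v a - v b)(w a - w b): for a generalized inverse X of L, the vector
-- v = X x_f is a potential of a unit current through f, that is, ⟨v , w⟩ = w k - w l for all w.
-- Symmetry of the form gives reciprocity (the drop of this potential along e equals the drop
-- along f of the potential for e), and deleting f subtracts (v k - v l)(w k - w l) from the form,
-- so all statements but (iii) amount to the vanishing of the mutual drop.
--
-- For (iii) one needs Kirchhoff's formula: r_G(f) τ(G) is the number of spanning trees through f.
-- It is proved by adding one edge x at a time to a graph in which a set B of edges is
-- short-circuited.  If s and r are the resistances of x and f before x is added and t is the
-- mutual drop, then the tree count is multiplied by 1 + s, and r becomes r - t²/(1 + s), while
-- contracting x instead gives r - t²/s.  If x is a bridge, the trees through f are compared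
-- with those through x by exchanging the two edges across the cut.
module Submission where

open import Defs
open import Data.Nat using (ℕ; zero; suc; _≥_; _*_; _∸_; _≤_; z≤n; s≤s)
import Data.Nat as ℕ
import Data.Nat.Properties as ℕ
open import Data.Fin using (Fin; punchIn; punchOut)
import Data.Fin as F
import Data.Fin.Properties as F
open import Data.Fin.Subset using (∣_∣)
import Data.Fin.Subset as Subset
import Data.Fin.Subset.Properties as Subset
import Data.Vec as Vector
import Data.Vec.Properties as Vector
open import Data.Bool using (Bool; true; false; if_then_else_; T; not; _∧_; _∨_)
import Data.Bool as Bool
open import Data.Bool.Properties using (T-∨; T-∧; T-≡; ∧-zeroʳ; ∨-zeroʳ; ∧-identityʳ; ∧-comm; ∨-comm)
open import Data.Unit using (⊤; tt)
open import Data.List using (List; _∷_; []; _++_; _ʳ++_; length; allFin; map; filterᵇ; concatMap; cartesianProduct; tabulate)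
import Data.List.Properties as List
open import Data.List.Membership.Propositional using (_∈_; lose)
open import Data.List.Membership.Propositional.Properties using (∈-allFin; ∈-filter⁺; ∈-cartesianProduct⁺)
open import Data.List.Relation.Unary.All using (All; []; _∷_)
import Data.List.Relation.Unary.All as All
import Data.List.Relation.Unary.All.Properties as All
open import Data.List.Relation.Unary.AllPairs using ([]; _∷_)
open import Data.List.Relation.Unary.Any using (here; there)
import Data.List.Relation.Unary.Any as Any
import Data.List.Relation.Unary.Any.Properties as Any
open import Data.List.Relation.Unary.Unique.Propositional using (Unique)
import Data.List.Relation.Unary.Unique.Propositional.Properties as Unique
open import Data.List.Relation.Binary.Permutation.Propositional using (_↭_; ↭-sym; ↭-trans)
import Data.List.Relation.Binary.Permutation.Propositional as ↭
import Data.List.Relation.Binary.Permutation.Propositional.Properties as ↭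
open import Data.Product using (_×_; _,_; proj₁; proj₂; ∃-syntax)
open import Data.Sum using (_⊎_; inj₁; inj₂)
open import Data.Empty using (⊥; ⊥-elim)
open import Data.Rational using (ℚ; 0ℚ; 1ℚ; _+_; _-_; -_; 1/_; ≢-nonZero) renaming (_*_ to _*ℚ_; _≤_ to _≤ℚ_)
import Data.Rational as ℚ
import Data.Rational.Properties as ℚ
open import Data.Rational.Solver using (module +-*-Solver)
open import Function using (_∘_)
open import Function.Bundles using (Equivalence; _⇔_; mk⇔)
open import Function.Construct.Composition using (_⇔-∘_)
open import Function.Construct.Symmetry using (⇔-sym)
open import Relation.Binary using (tri<; tri≈; tri>)
open import Relation.Binary.PropositionalEquality
open import Relation.Nullary using (¬_; yes; no)
open import Relation.Nullary.Decidable using (⌊_⌋; toWitness; fromWitness)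
open +-*-Solver

-- Field and order arithmetic of the rationals.

inverse : ∀ {s} → s ≢ 0ℚ → ∃[ c ] s *ℚ c ≡ 1ℚ
inverse {s} s≢0 = (1/ s) , ℚ.*-inverseʳ s
  where instance _ = ≢-nonZero s≢0

*-zero-factor : ∀ x y → x *ℚ y ≡ 0ℚ → x ≢ 0ℚ → y ≡ 0ℚ
*-zero-factor x y xy≡0 x≢0 with inverse x≢0
... | c , xc≡1 = begin
  y                ≡⟨ solve 1 (λ y → y := con 1ℚ :* y) refl y ⟩
  1ℚ *ℚ y          ≡⟨ cong (_*ℚ y) (sym xc≡1) ⟩
  (x *ℚ c) *ℚ y    ≡⟨ solve 3 (λ x c y → (x :* c) :* y := c :* (x :* y)) refl x c y ⟩
  c *ℚ (x *ℚ y)    ≡⟨ cong (c *ℚ_) xy≡0 ⟩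
  c *ℚ 0ℚ          ≡⟨ ℚ.*-zeroʳ c ⟩
  0ℚ               ∎
  where open ≡-Reasoning

square-zero : ∀ x → x *ℚ x ≡ 0ℚ → x ≡ 0ℚ
square-zero x xx≡0 with x ℚ.≟ 0ℚ
... | yes x≡0 = x≡0
... | no x≢0 = *-zero-factor x x xx≡0 x≢0

diff≡0⇒≡ : ∀ {x y} → x - y ≡ 0ℚ → x ≡ y
diff≡0⇒≡ {x} {y} eq = begin
  x            ≡⟨ solve 2 (λ x y → x := (x :- y) :+ y) refl x y ⟩
  (x - y) + y  ≡⟨ cong (_+ y) eq ⟩
  0ℚ + y       ≡⟨ ℚ.+-identityˡ y ⟩
  y            ∎
  where open ≡-Reasoning

≡⇒diff≡0 : ∀ {x y} → x ≡ y → x - y ≡ 0ℚ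
≡⇒diff≡0 {x} refl = ℚ.+-inverseʳ x

square-nonneg : ∀ x → 0ℚ ≤ℚ x *ℚ x
square-nonneg x with ℚ.≤-total 0ℚ x
... | inj₁ 0≤x = subst (_≤ℚ x *ℚ x) (ℚ.*-zeroˡ x) (ℚ.*-monoʳ-≤-nonNeg x 0≤x)
  where instance _ = ℚ.nonNegative 0≤x
... | inj₂ x≤0 = subst (_≤ℚ x *ℚ x) (ℚ.*-zeroˡ x) (ℚ.*-monoʳ-≤-nonPos x x≤0)
  where instance _ = ℚ.nonPositive x≤0

nonneg-sum-zero : ∀ {x y} → 0ℚ ≤ℚ x → 0ℚ ≤ℚ y → x + y ≡ 0ℚ → x ≡ 0ℚ × y ≡ 0ℚ
nonneg-sum-zero {x} {y} 0≤x 0≤y x+y≡0 = x≡0 , trans (sym (trans (cong (_+ y) x≡0) (ℚ.+-identityˡ y))) x+y≡0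
  where
  x≡0 : x ≡ 0ℚ
  x≡0 = ℚ.≤-antisym (subst₂ _≤ℚ_ (ℚ.+-identityʳ x) x+y≡0 (ℚ.+-monoʳ-≤ x 0≤y)) 0≤x

one-plus-nonneg≢0 : ∀ {s} → 0ℚ ≤ℚ s → 1ℚ + s ≢ 0ℚ
one-plus-nonneg≢0 0≤s eq with nonneg-sum-zero {1ℚ} (ℚ.nonNegative⁻¹ 1ℚ) 0≤s eq
... | () , _

-- Energy forms and potentials

Edge : ℕ → Set
Edge n = Fin n × Fin n

δ : ∀ {n} → Edge n → Vec n → ℚ
δ e w = w (proj₁ e) - w (proj₂ e)

energy : ∀ {n} → List (Edge n) → Vec n → Vec n → ℚ
energy []       v w = 0ℚ
energy (e ∷ es) v w = δ e v *ℚ δ e w + energy es v w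

Flat : ∀ {n} → List (Edge n) → Vec n → Set
Flat es w = All (λ e → δ e w ≡ 0ℚ) es

axpy : ∀ {n} → Vec n → ℚ → Vec n → Vec n
axpy v c u a = v a + c *ℚ u a

δ-axpy : ∀ {n} (e : Edge n) v c u → δ e (axpy v c u) ≡ δ e v + c *ℚ δ e u
δ-axpy (a , b) v c u =
  solve 5 (λ va vb c ua ub → (va :+ c :* ua) :- (vb :+ c :* ub) := (va :- vb) :+ c :* (ua :- ub))
    refl (v a) (v b) c (u a) (u b)

δ-axpy-zero : ∀ {n} (e : Edge n) v c u → δ e v ≡ 0ℚ → δ e u ≡ 0ℚ → δ e (axpy v c u) ≡ 0ℚ
δ-axpy-zero e v c u p q = begin
  δ e (axpy v c u)       ≡⟨ δ-axpy e v c u ⟩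
  δ e v + c *ℚ δ e u     ≡⟨ cong₂ (λ x y → x + c *ℚ y) p q ⟩
  0ℚ + c *ℚ 0ℚ           ≡⟨ solve 1 (λ c → con 0ℚ :+ c :* con 0ℚ := con 0ℚ) refl c ⟩
  0ℚ                     ∎
  where open ≡-Reasoning

Flat-axpy : ∀ {n} {es : List (Edge n)} v c u → Flat es v → Flat es u → Flat es (axpy v c u)
Flat-axpy v c u []       []       = []
Flat-axpy {es = e ∷ _} v c u (p ∷ ps) (q ∷ qs) = δ-axpy-zero e v c u p q ∷ Flat-axpy v c u ps qs

energy-sym : ∀ {n} (es : List (Edge n)) v w → energy es v w ≡ energy es w v
energy-sym []       v w = refl
energy-sym (e ∷ es) v w = cong₂ _+_ (ℚ.*-comm (δ e v) (δ e w)) (energy-sym es v w)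

energy-axpy : ∀ {n} (es : List (Edge n)) v c u w →
  energy es (axpy v c u) w ≡ energy es v w + c *ℚ energy es u w
energy-axpy [] v c u w = solve 1 (λ c → con 0ℚ := con 0ℚ :+ c :* con 0ℚ) refl c
energy-axpy (e ∷ es) v c u w = begin
  δ e (axpy v c u) *ℚ δ e w + energy es (axpy v c u) w
    ≡⟨ cong₂ (λ x y → x *ℚ δ e w + y) (δ-axpy e v c u) (energy-axpy es v c u w) ⟩
  (δ e v + c *ℚ δ e u) *ℚ δ e w + (energy es v w + c *ℚ energy es u w)
    ≡⟨ solve 6 (λ x y z c p q → (x :+ c :* y) :* z :+ (p :+ c :* q) := (x :* z :+ p) :+ c :* (y :* z :+ q))
         refl (δ e v) (δ e u) (δ e w) c (energy es v w) (energy es u w) ⟩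
  (δ e v *ℚ δ e w + energy es v w) + c *ℚ (δ e u *ℚ δ e w + energy es u w) ∎
  where open ≡-Reasoning

energy-axpyʳ : ∀ {n} (es : List (Edge n)) v w c u →
  energy es v (axpy w c u) ≡ energy es v w + c *ℚ energy es v u
energy-axpyʳ es v w c u = begin
  energy es v (axpy w c u)                ≡⟨ energy-sym es v (axpy w c u) ⟩
  energy es (axpy w c u) v                ≡⟨ energy-axpy es w c u v ⟩
  energy es w v + c *ℚ energy es u v      ≡⟨ cong₂ (λ x y → x + c *ℚ y) (energy-sym es w v) (energy-sym es u v) ⟩
  energy es v w + c *ℚ energy es v u      ∎
  where open ≡-Reasoning

energy-nonneg : ∀ {n} (es : List (Edge n)) v → 0ℚ ≤ℚ energy es v v
energy-nonneg []       v = ℚ.≤-refl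
energy-nonneg (e ∷ es) v = ℚ.+-mono-≤ (square-nonneg (δ e v)) (energy-nonneg es v)

energy-zero⇒Flat : ∀ {n} (es : List (Edge n)) v → energy es v v ≡ 0ℚ → Flat es v
energy-zero⇒Flat []       v _  = []
energy-zero⇒Flat (e ∷ es) v eq with nonneg-sum-zero (square-nonneg (δ e v)) (energy-nonneg es v) eq
... | p , q = square-zero (δ e v) p ∷ energy-zero⇒Flat es v q

energy-Flat : ∀ {n} {es : List (Edge n)} v q → Flat es q → energy es v q ≡ 0ℚ
energy-Flat v q [] = refl
energy-Flat {es = e ∷ es} v q (p ∷ ps) =
  cong₂ _+_ (trans (cong (δ e v *ℚ_) p) (ℚ.*-zeroʳ (δ e v))) (energy-Flat v q ps)

-- The potential of a unit current through f in the graph with edges es and the edges in B short-circuited.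
Potential : ∀ {n} → List (Edge n) → List (Edge n) → Edge n → Vec n → Set
Potential B es f v = Flat B v × (∀ w → Flat B w → energy es v w ≡ δ f w)

-- Each potential is an admissible test vector for the other, so both drops equal `energy es v u`.
-- Taken with `f` and `g` equal, this shows that the drop along `f` does not depend on the chosen
-- potential.
reciprocity : ∀ {n} {B : List (Edge n)} es {f g} v u →
  Potential B es f v → Potential B es g u → δ g v ≡ δ f u
reciprocity es v u (bv , pv) (bu , pu) =
  trans (sym (pu v bv)) (trans (energy-sym es u v) (pv u bu))

-- Connectedness in dual form, through functions instead of paths, so that it applies directly to
-- the vectors on which the energy form vanishes.
Spans : ∀ {n} → List (Edge n) → Set
Spans {n} es = ∀ w → Flat es w → ∀ (a b : Fin n) → w a ≡ w b

-- Contractions and spanning edge sets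

-- The quotient of the vertex set by the connected components of `B`, `m` in number. The field
-- `faithful` keeps classes from being larger than components by testing them with vectors.
record Contraction {n} (B : List (Edge n)) (m : ℕ) : Set where
  field
    class      : Fin n → Fin m
    surjective : ∀ y → ∃[ x ] class x ≡ y
    merges     : All (λ e → class (proj₁ e) ≡ class (proj₂ e)) B
    faithful   : ∀ w → Flat B w → ∀ a b → class a ≡ class b → w a ≡ w b

open Contraction

contract-[] : ∀ n → Contraction {n} [] n
contract-[] n = record
  { class = λ a → a ; surjective = λ y → y , refl ; merges = []
  ; faithful = λ w _ a b a≡b → cong w a≡b }

redirect : ∀ {m} → Fin m → Fin m → Fin m → Fin m
redirect y z v with v F.≟ y
... | yes _ = z
... | no  _ = v

redirect-source : ∀ {m} (y z : Fin m) → redirect y z y ≡ z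
redirect-source y z with y F.≟ y
... | yes _  = refl
... | no y≢y = ⊥-elim (y≢y refl)

redirect-other : ∀ {m} (y z v : Fin m) → v ≢ y → redirect y z v ≡ v
redirect-other y z v v≢y with v F.≟ y
... | yes v≡y = ⊥-elim (v≢y v≡y)
... | no _    = refl

redirect-avoids : ∀ {m} (y z v : Fin m) → y ≢ z → y ≢ redirect y z v
redirect-avoids y z v y≢z with v F.≟ y
... | yes _  = y≢z
... | no v≢y = v≢y ∘ sym

redirect-cases : ∀ {m} (y z v : Fin m) → (v ≡ y × redirect y z v ≡ z) ⊎ redirect y z v ≡ v
redirect-cases y z v with v F.≟ y
... | yes v≡y = inj₁ (v≡y , refl)
... | no _    = inj₂ refl

-- The class of one end of `x` is redirected to the class of the other; the vacated index is then
-- removed by `punchOut`, so exactly one class is lost.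
contract-∷ : ∀ {n m} {B : List (Edge n)} (C : Contraction B (suc m)) (x : Edge n) →
  class C (proj₁ x) ≢ class C (proj₂ x) → Contraction (x ∷ B) m
contract-∷ {n} {m} {B} C (a , b) y≢z = record
  { class      = class′
  ; surjective = surjective′
  ; merges     = class′-cong (trans (redirect-source y z) (sym (redirect-other y z z (y≢z ∘ sym))))
                 ∷ All.map (λ eq → class′-cong (cong (redirect y z) eq)) (merges C)
  ; faithful   = faithful′ }
  where
  y z : Fin (suc m)
  y = class C a
  z = class C b
  class′ : Fin n → Fin m
  class′ v = punchOut (redirect-avoids y z (class C v) y≢z)
  class′-cong : ∀ {u v} → redirect y z (class C u) ≡ redirect y z (class C v) → class′ u ≡ class′ v
  class′-cong = F.punchOut-cong y
  surjective′ : ∀ t → ∃[ v ] class′ v ≡ t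
  surjective′ t with surjective C (punchIn y t)
  ... | v , cv≡ = v , trans (F.punchOut-cong y (trans (cong (redirect y z) cv≡)
                    (redirect-other y z (punchIn y t) (F.punchInᵢ≢i y t)))) (F.punchOut-punchIn y)
  faithful′ : ∀ w → Flat ((a , b) ∷ B) w → ∀ u v → class′ u ≡ class′ v → w u ≡ w v
  faithful′ w (wab ∷ wB) u v eq
    with F.punchOut-injective (redirect-avoids y z (class C u) y≢z) (redirect-avoids y z (class C v) y≢z) eq
       | redirect-cases y z (class C u) | redirect-cases y z (class C v)
  ... | ru≡rv | inj₁ (cu , _) | inj₁ (cv , _) = faithful C w wB u v (trans cu (sym cv))
  ... | ru≡rv | inj₁ (cu , ru) | inj₂ rv =
    trans (faithful C w wB u a cu) (trans (diff≡0⇒≡ wab) (faithful C w wB b v (trans (sym ru) (trans ru≡rv rv))))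
  ... | ru≡rv | inj₂ ru | inj₁ (cv , rv) =
    sym (trans (faithful C w wB v a cv) (trans (diff≡0⇒≡ wab) (faithful C w wB b u (trans (sym rv) (trans (sym ru≡rv) ru)))))
  ... | ru≡rv | inj₂ ru | inj₂ rv = faithful C w wB u v (trans (sym ru) (trans ru≡rv rv))

-- An edge within a class leaves the classes alone and any other edge merges two of them, so each
-- edge lowers the number of classes by at most one.
contract : ∀ {n} (B : List (Edge n)) → ∃[ m ] Contraction B m × n ≤ m ℕ.+ length B
contract {n} [] = n , contract-[] n , ℕ.m≤m+n n 0
contract (x ∷ B) with contract B
... | zero , C , _ with class C (proj₁ x)
...   | ()
contract {n} (x ∷ B) | suc m , C , n≤ with class C (proj₁ x) F.≟ class C (proj₂ x)
... | no  c≢ = m , contract-∷ C x c≢ , subst (n ≤_) (sym (ℕ.+-suc m (length B))) n≤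
... | yes c≡ = suc m , C′ , ℕ.≤-trans n≤ (ℕ.+-monoʳ-≤ (suc m) (ℕ.n≤1+n (length B)))
  where
  C′ : Contraction (x ∷ B) (suc m)
  C′ = record { class = class C ; surjective = surjective C ; merges = c≡ ∷ merges C
              ; faithful = λ { w (_ ∷ wB) → faithful C w wB } }

indicator : ∀ {n} → (Fin n → Bool) → Vec n
indicator p v = if p v then 1ℚ else 0ℚ

indicator-injective : ∀ x y → (if x then 1ℚ else 0ℚ) ≡ (if y then 1ℚ else 0ℚ) → x ≡ y
indicator-injective true true _ = refl
indicator-injective false false _ = refl
indicator-injective true false ()
indicator-injective false true ()

==-refl : ∀ {n} (a : Fin n) → (a == a) ≡ true
==-refl a with a F.≟ a
... | yes _  = refl
... | no a≢a = ⊥-elim (a≢a refl)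

==⇒≡ : ∀ {n} (a b : Fin n) → (a == b) ≡ true → a ≡ b
==⇒≡ a b eq with a F.≟ b
... | yes a≡b = a≡b

-- The indicator of a single class is flat on `B`, hence constant, hence that class is everything.
spanning-contraction : ∀ {n m} {B : List (Edge n)} → Spans B → Contraction B m → ∀ (y z : Fin m) → y ≡ z
spanning-contraction {B = B} span C y z with surjective C y | surjective C z
... | a , ca≡y | b , cb≡z = trans (sym cb==y) cb≡z
  where
  p : _ → Bool
  p v = class C v == y
  flat : Flat B (indicator p)
  flat = All.map (λ {e} eq → ≡⇒diff≡0 (cong (λ u → if u == y then 1ℚ else 0ℚ) eq)) (merges C)
  cb==y : class C b ≡ y
  cb==y = ==⇒≡ (class C b) y (trans (indicator-injective (p b) (p a) (span (indicator p) flat b a))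
            (trans (cong (_== y) ca≡y) (==-refl y)))

-- The contraction by `B` has at most one class, while `n` is at most the number of classes plus the
-- number of edges.
spanning-length : ∀ {n} (B : List (Edge n)) → Spans B → n ∸ 1 ≤ length B
spanning-length B span with contract B
... | zero  , C , n≤ = ℕ.≤-trans (ℕ.m∸n≤m _ 1) n≤
... | suc zero , C , n≤ = ℕ.∸-monoˡ-≤ 1 n≤
... | suc (suc m) , C , n≤ with spanning-contraction span C F.zero (F.suc F.zero)
...   | ()

-- Boolean reachability and its agreement with `Spans`.

edgeAdj-Flat : ∀ {n} (s : List (Edge n)) w → Flat s w → ∀ c d → T (edgeAdj s c d) → w c ≡ w d
edgeAdj-Flat ((x , y) ∷ s) w (p ∷ ps) c d t with Equivalence.to T-∨ t
... | inj₂ t′ = edgeAdj-Flat s w ps c d t′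
... | inj₁ t′ with Equivalence.to T-∨ t′
...   | inj₁ t″ with Equivalence.to T-∧ t″
...     | x=c , y=d = subst₂ (λ u v → w u ≡ w v) (toWitness {a? = x F.≟ c} x=c) (toWitness {a? = y F.≟ d} y=d) (diff≡0⇒≡ p)
edgeAdj-Flat ((x , y) ∷ s) w (p ∷ ps) c d t | inj₁ t′ | inj₂ t″ with Equivalence.to T-∧ t″
...     | x=d , y=c = sym (subst₂ (λ u v → w u ≡ w v) (toWitness {a? = x F.≟ d} x=d) (toWitness {a? = y F.≟ c} y=c) (diff≡0⇒≡ p))

anyFin⁻ : ∀ {n} (p : Fin n → Bool) → T (anyFin p) → ∃[ c ] T (p c)
anyFin⁻ {n} p t = Any.satisfied (Any.any⁻ p (allFin n) t)

anyFin⁺ : ∀ {n} (p : Fin n → Bool) c → T (p c) → T (anyFin p)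
anyFin⁺ p c t = Any.any⁺ p (lose (∈-allFin c) t)

reach-Flat : ∀ {n} (s : List (Edge n)) w → Flat s w → ∀ k a b → T (reach s k a b) → w a ≡ w b
reach-Flat s w fl zero a b t = cong w (toWitness {a? = a F.≟ b} t)
reach-Flat s w fl (suc k) a b t with Equivalence.to T-∨ t
... | inj₁ t′ = reach-Flat s w fl k a b t′
... | inj₂ t′ with anyFin⁻ _ t′
...   | c , t″ with Equivalence.to T-∧ t″
...     | ac , cb = trans (reach-Flat s w fl k a c ac) (edgeAdj-Flat s w fl c b cb)

Closed : ∀ {n} → List (Edge n) → (Fin n → Bool) → Set
Closed s p = ∀ b c → T (p b) → T (edgeAdj s b c) → T (p c)

∈-tabulate⁺ : ∀ {n} (p : Fin n → Bool) {b} → T (p b) → b Subset.∈ Vector.tabulate p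
∈-tabulate⁺ p {b} t = Vector.lookup⇒[]= b (Vector.tabulate p)
  (trans (Vector.lookup∘tabulate p b) (Equivalence.to T-≡ t))

∈-tabulate⁻ : ∀ {n} (p : Fin n → Bool) {b} → b Subset.∈ Vector.tabulate p → T (p b)
∈-tabulate⁻ p {b} m = Equivalence.from T-≡
  (trans (sym (Vector.lookup∘tabulate p b)) (Vector.[]=⇒lookup m))

reach-suc : ∀ {n} (s : List (Edge n)) k a b → T (reach s k a b) → T (reach s (suc k) a b)
reach-suc s k a b t = Equivalence.from T-∨ (inj₁ t)

reach-step : ∀ {n} (s : List (Edge n)) k a b c → T (reach s k a b) → T (edgeAdj s b c) → T (reach s (suc k) a c)
reach-step s k a b c t e = Equivalence.from T-∨ (inj₂ (anyFin⁺ _ b (Equivalence.from T-∧ (t , e))))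

reach-refl : ∀ {n} (s : List (Edge n)) k (a : Fin n) → T (reach s k a a)
reach-refl s zero    a = fromWitness {a? = a F.≟ a} refl
reach-refl s (suc k) a = reach-suc s k a a (reach-refl s k a)

T-not-both : ∀ x → T x → T (not x) → ⊥
T-not-both true _ ()

T-stable : ∀ x → (T (not x) → ⊥) → T x
T-stable true  _ = tt
T-stable false f = f tt

Closed-suc : ∀ {n} (s : List (Edge n)) k a → Closed s (reach s k a) → Closed s (reach s (suc k) a)
Closed-suc s k a cl b c t e = reach-step s k a b c (back t) e
  where
  back : T (reach s (suc k) a b) → T (reach s k a b)
  back t with Equivalence.to T-∨ t
  ... | inj₁ t′ = t′
  ... | inj₂ t′ with anyFin⁻ _ t′
  ...   | d , t″ with Equivalence.to T-∧ t″
  ...     | ad , db = cl d b ad db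

-- As long as the reached set is not closed it gains a vertex at every step.
Closed-or-large : ∀ {n} (s : List (Edge n)) k (a : Fin n) →
  Closed s (reach s k a) ⊎ suc k ≤ ∣ Vector.tabulate (reach s k a) ∣
Closed-or-large s zero a = inj₂ (ℕ.≤-trans (s≤s z≤n) (Subset.p⊂q⇒∣p∣<∣q∣
  (Subset.⊥⊆ , a , ∈-tabulate⁺ (reach s zero a) (reach-refl s zero a) , Subset.∉⊥)))
Closed-or-large {n} s (suc k) a with Closed-or-large s k a
... | inj₁ cl = inj₁ (Closed-suc s k a cl)
... | inj₂ large with F.any? (λ c → Bool.T? (reach s (suc k) a c ∧ not (reach s k a c)))
...   | yes (c , t) = inj₂ (ℕ.<-≤-trans (s≤s large) (Subset.p⊂q⇒∣p∣<∣q∣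
          ( (λ m → ∈-tabulate⁺ _ (reach-suc s k a _ (∈-tabulate⁻ (reach s k a) m)))
          , c , ∈-tabulate⁺ (reach s (suc k) a) (proj₁ (Equivalence.to T-∧ t))
          , λ m → T-not-both (reach s k a c) (∈-tabulate⁻ (reach s k a) m) (proj₂ (Equivalence.to T-∧ t)))))
...   | no none = inj₁ (Closed-suc s k a λ b c t e →
          T-stable (reach s k a c) λ nt → none (c , Equivalence.from T-∧ (reach-step s k a b c t e , nt)))

-- If the set were still growing after `n` steps, it would have more than `n` elements.
reach-Closed : ∀ {n} (s : List (Edge n)) (a : Fin n) → Closed s (reach s n a)
reach-Closed {n} s a with Closed-or-large s n a
... | inj₁ cl = cl
... | inj₂ large = ⊥-elim (ℕ.<-irrefl refl (ℕ.≤-trans large (Subset.∣p∣≤n (Vector.tabulate (reach s n a)))))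

edgeAdj-head : ∀ {n} (s : List (Edge n)) x y → T (edgeAdj ((x , y) ∷ s) x y) × T (edgeAdj ((x , y) ∷ s) y x)
edgeAdj-head s x y rewrite ==-refl x | ==-refl y = tt , Equivalence.from T-∨ (inj₁ (Equivalence.from (T-∨ {x == y ∧ y == x}) (inj₂ tt)))

T-ext : ∀ x y → (T x → T y) → (T y → T x) → x ≡ y
T-ext true  true  _ _ = refl
T-ext false false _ _ = refl
T-ext true  false f _ = ⊥-elim (f tt)
T-ext false true  _ g = ⊥-elim (g tt)

Closed⇒Flat : ∀ {n} (s : List (Edge n)) p → Closed s p → Flat s (indicator p)
Closed⇒Flat []            p cl = []
Closed⇒Flat ((x , y) ∷ s) p cl =
  ≡⇒diff≡0 (cong (λ b → if b then 1ℚ else 0ℚ)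
    (T-ext (p x) (p y) (λ t → cl x y t (proj₁ (edgeAdj-head s x y)))
                       (λ t → cl y x t (proj₂ (edgeAdj-head s x y)))))
  ∷ Closed⇒Flat s p (λ b c t e → cl b c t (Equivalence.from T-∨ (inj₂ e)))

reach⇒connectedᵇ : ∀ {n} (s : List (Edge n)) → (∀ a b → T (reach s n a b)) → T (connectedᵇ s)
reach⇒connectedᵇ {n} s r = All.all⁻ _ (All.tabulate {xs = allFin n} λ {a} _ →
  All.all⁻ (reach s n a) (All.tabulate {xs = allFin n} λ {b} _ → r a b))

connectedᵇ⇒reach : ∀ {n} (s : List (Edge n)) → T (connectedᵇ s) → ∀ a b → T (reach s n a b)
connectedᵇ⇒reach {n} s t a b =
  All.lookup (All.all⁺ (reach s n a) (allFin n) (All.lookup (All.all⁺ _ (allFin n) t) (∈-allFin a))) (∈-allFin b)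

-- The set reached from `a` is closed, so its indicator is flat and therefore constant; its value at
-- `a` is one.
Spans⇒connectedᵇ : ∀ {n} (s : List (Edge n)) → Spans s → T (connectedᵇ s)
Spans⇒connectedᵇ {n} s span = reach⇒connectedᵇ s λ a b →
  subst T (indicator-injective (reach s n a a) (reach s n a b)
            (span (indicator (reach s n a)) (Closed⇒Flat s (reach s n a) (reach-Closed s a)) a b))
          (reach-refl s n a)

connectedᵇ⇒Spans : ∀ {n} (s : List (Edge n)) → T (connectedᵇ s) → Spans s
connectedᵇ⇒Spans {n} s t w fl a b = reach-Flat s w fl n a b (connectedᵇ⇒reach s t a b)

-- When some `b` is not reached from `a`, the component of `a` is the cut. This dichotomy later
-- decides whether an edge is a bridge.
Spans-or-cut : ∀ {n} (s : List (Edge n)) →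
  Spans s ⊎ (∃[ p ] Flat s (indicator p) × ∃[ a ] ∃[ b ] indicator p a ≢ indicator p b)
Spans-or-cut {n} s with F.any? (λ a → F.any? (λ b → Bool.T? (not (reach s n a b))))
... | yes (a , b , t) = inj₂ (reach s n a , Closed⇒Flat s (reach s n a) (reach-Closed s a) , a , b ,
        λ eq → T-not-both (reach s n a b) (subst T (indicator-injective (reach s n a a) (reach s n a b) eq) (reach-refl s n a)) t)
... | no none = inj₁ λ w fl a b → reach-Flat s w fl n a b (T-stable (reach s n a b) λ t → none (a , b , t))

SpanningTree : ∀ {n} → List (Edge n) → Set
SpanningTree {n} s = length s ≡ n ∸ 1 × Spans s

isSpanningTreeᵇ⇒ : ∀ {n} (s : List (Edge n)) → T (isSpanningTreeᵇ s) → SpanningTree s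
isSpanningTreeᵇ⇒ {n} s t with Equivalence.to (T-∧ {length s ℕ.≡ᵇ (n ∸ 1)}) t
... | len , conn = ℕ.≡ᵇ⇒≡ (length s) (n ∸ 1) len , connectedᵇ⇒Spans s conn

⇒isSpanningTreeᵇ : ∀ {n} (s : List (Edge n)) → SpanningTree s → T (isSpanningTreeᵇ s)
⇒isSpanningTreeᵇ {n} s (len , span) =
  Equivalence.from T-∧ (ℕ.≡⇒≡ᵇ (length s) (n ∸ 1) len , Spans⇒connectedᵇ s span)

-- Kirchhoff's formula

treeValue : ∀ {n} → List (Edge n) → ℚ
treeValue s = if isSpanningTreeᵇ s then 1ℚ else 0ℚ

-- The number of spanning trees consisting of B and some of the edges in es.
trees : ∀ {n} → List (Edge n) → List (Edge n) → ℚ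
trees B []       = treeValue B
trees B (x ∷ es) = trees B es + trees (x ∷ B) es

treeValue-cong : ∀ {n} (s t : List (Edge n)) →
  (SpanningTree s → SpanningTree t) → (SpanningTree t → SpanningTree s) → treeValue s ≡ treeValue t
treeValue-cong s t f g = cong (λ b → if b then 1ℚ else 0ℚ) (T-ext (isSpanningTreeᵇ s) (isSpanningTreeᵇ t)
  (⇒isSpanningTreeᵇ t ∘ f ∘ isSpanningTreeᵇ⇒ s) (⇒isSpanningTreeᵇ s ∘ g ∘ isSpanningTreeᵇ⇒ t))

treeValue-zero : ∀ {n} (s : List (Edge n)) → ¬ SpanningTree s → treeValue s ≡ 0ℚ
treeValue-zero s ¬st with isSpanningTreeᵇ s in eq
... | true  = ⊥-elim (¬st (isSpanningTreeᵇ⇒ s (subst T (sym eq) tt)))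
... | false = refl

SpanningTree-↭ : ∀ {n} {s t : List (Edge n)} → s ↭ t → SpanningTree s → SpanningTree t
SpanningTree-↭ s↭t (len , span) =
  trans (sym (↭.↭-length s↭t)) len , λ w fl → span w (↭.All-resp-↭ (↭-sym s↭t) fl)

treeValue-↭ : ∀ {n} {s t : List (Edge n)} → s ↭ t → treeValue s ≡ treeValue t
treeValue-↭ {s = s} {t} s↭t = treeValue-cong s t (SpanningTree-↭ s↭t) (SpanningTree-↭ (↭-sym s↭t))

-- Both sums branch over the same subsets `s` of `es`, so a proportionality valid for each `s`
-- passes to the sums. The predicate `P` carries to `s` what is known of every edge in `es`.
trees-scale : ∀ {n} (P : Edge n → Set) (c : ℚ) (B B′ : List (Edge n)) →
  (∀ s → All P s → treeValue (s ++ B) ≡ c *ℚ treeValue (s ++ B′)) →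
  ∀ es → All P es → trees B es ≡ c *ℚ trees B′ es
trees-scale P c B B′ h es Pes = go es Pes [] []
  where
  go : ∀ es → All P es → ∀ s → All P s → trees (s ++ B) es ≡ c *ℚ trees (s ++ B′) es
  go [] [] s Ps = h s Ps
  go (x ∷ es) (Px ∷ Pes) s Ps =
    trans (cong₂ _+_ (go es Pes s Ps) (go es Pes (x ∷ s) (Px ∷ Ps)))
          (sym (ℚ.*-distribˡ-+ c (trees (s ++ B′) es) (trees (x ∷ s ++ B′) es)))

trees-↭ : ∀ {n} {B B′ : List (Edge n)} → B ↭ B′ → ∀ es → trees B es ≡ trees B′ es
trees-↭ p []       = treeValue-↭ p
trees-↭ p (x ∷ es) = cong₂ _+_ (trees-↭ p es) (trees-↭ (↭.prep x p) es)

-- Cuts and the exchange of crossing edges.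

δ-indicator : ∀ {n} (p : Fin n → Bool) (e : Edge n) →
  δ e (indicator p) ≡ 0ℚ ⊎ δ e (indicator p) *ℚ δ e (indicator p) ≡ 1ℚ
δ-indicator p (a , b) with p a | p b
... | true  | true  = inj₁ refl
... | true  | false = inj₂ refl
... | false | true  = inj₂ refl
... | false | false = inj₁ refl

square-one⇒≢0 : ∀ {x} → x *ℚ x ≡ 1ℚ → x ≢ 0ℚ
square-one⇒≢0 () refl

-- A vector `w` flat on `x ∷ s` is corrected by a multiple of `q` to be flat on `f ∷ s`, hence
-- constant. Comparing drops along `x`, which crosses the cut, shows that the correction was zero,
-- so `w` itself is flat on `f`.
exchange : ∀ {n} (s : List (Edge n)) (f x : Edge n) q → Flat s q → δ f q *ℚ δ f q ≡ 1ℚ → δ x q *ℚ δ x q ≡ 1ℚ →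
  Spans (f ∷ s) → Spans (x ∷ s)
exchange s f x q flat ff xx span w (wx ∷ ws) = span w (wf ∷ ws)
  where
  open ≡-Reasoning
  c : ℚ
  -- The drop of `q` along `f` is its own inverse, so adding this multiple of `q` cancels the drop
  -- of `w` along `f`.
  c = - (δ f w *ℚ δ f q)
  w′ = axpy w c q
  f-flat : δ f w′ ≡ 0ℚ
  f-flat = begin
    δ f w′                                   ≡⟨ δ-axpy f w c q ⟩
    δ f w + (- (δ f w *ℚ δ f q)) *ℚ δ f q    ≡⟨ solve 2 (λ a b → a :+ (:- (a :* b)) :* b := a :- a :* (b :* b)) refl (δ f w) (δ f q) ⟩
    δ f w - δ f w *ℚ (δ f q *ℚ δ f q)        ≡⟨ cong (λ z → δ f w - δ f w *ℚ z) ff ⟩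
    δ f w - δ f w *ℚ 1ℚ                      ≡⟨ solve 1 (λ a → a :- a :* con 1ℚ := con 0ℚ) refl (δ f w) ⟩
    0ℚ                                       ∎
  x-flat : c *ℚ δ x q ≡ 0ℚ
  x-flat = begin
    c *ℚ δ x q             ≡⟨ sym (ℚ.+-identityˡ _) ⟩
    0ℚ + c *ℚ δ x q        ≡⟨ cong (_+ c *ℚ δ x q) (sym wx) ⟩
    δ x w + c *ℚ δ x q     ≡⟨ sym (δ-axpy x w c q) ⟩
    δ x w′                 ≡⟨ ≡⇒diff≡0 (span w′ (f-flat ∷ Flat-axpy w c q ws flat) _ _) ⟩
    0ℚ                     ∎
  c≡0 : c ≡ 0ℚ
  c≡0 = *-zero-factor (δ x q) c (trans (ℚ.*-comm (δ x q) c) x-flat) (square-one⇒≢0 xx)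
  wf : δ f w ≡ 0ℚ
  wf = begin
    δ f w                          ≡⟨ solve 2 (λ a y → a := a :+ con 0ℚ :* y) refl (δ f w) (δ f q) ⟩
    δ f w + 0ℚ *ℚ δ f q            ≡⟨ cong (λ z → δ f w + z *ℚ δ f q) (sym c≡0) ⟩
    δ f w + c *ℚ δ f q             ≡⟨ sym (δ-axpy f w c q) ⟩
    δ f w′                         ≡⟨ f-flat ⟩
    0ℚ                             ∎

-- The squared drop is one or zero according to whether `f` crosses the cut, regardless of
-- orientation. If it does, `f` and `x` can be exchanged; if not, nothing in `f ∷ s` crosses the cut
-- and there is no tree.
cut-treeValue : ∀ {n} (s : List (Edge n)) (f x : Edge n) p → Flat s (indicator p) →
  δ x (indicator p) *ℚ δ x (indicator p) ≡ 1ℚ →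
  treeValue (f ∷ s) ≡ (δ f (indicator p) *ℚ δ f (indicator p)) *ℚ treeValue (x ∷ s)
cut-treeValue s f x p flat xx with δ-indicator p f
... | inj₁ f0 = trans (treeValue-zero (f ∷ s) λ { (_ , span) →
                  square-one⇒≢0 xx (≡⇒diff≡0 (span (indicator p) (f0 ∷ flat) _ _)) })
                (sym (trans (cong (λ z → (z *ℚ z) *ℚ treeValue (x ∷ s)) f0) (ℚ.*-zeroˡ (treeValue (x ∷ s)))))
... | inj₂ ff = trans (treeValue-cong (f ∷ s) (x ∷ s)
                  (λ { (len , span) → len , exchange s f x (indicator p) flat ff xx span })
                  (λ { (len , span) → len , exchange s x f (indicator p) flat xx ff span }))
                (sym (trans (cong (_*ℚ treeValue (x ∷ s)) ff) (ℚ.*-identityˡ (treeValue (x ∷ s)))))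

cut-trees : ∀ {n} (B es : List (Edge n)) (f x : Edge n) p → Flat B (indicator p) → Flat es (indicator p) →
  δ x (indicator p) *ℚ δ x (indicator p) ≡ 1ℚ →
  trees (f ∷ B) es ≡ (δ f (indicator p) *ℚ δ f (indicator p)) *ℚ trees (x ∷ B) es
cut-trees B es f x p Bq esq xx = trees-scale _ (δ f (indicator p) *ℚ δ f (indicator p)) (f ∷ B) (x ∷ B) (λ s sq →
  trans (treeValue-↭ (↭.shift f s B))
  (trans (cut-treeValue (s ++ B) f x p (All.++⁺ sq Bq) xx)
  (cong ((δ f (indicator p) *ℚ δ f (indicator p)) *ℚ_) (treeValue-↭ (↭-sym (↭.shift x s B)))))) es esq

-- The nonconstant vector `q` is flat on every candidate edge set, so none of them spans. This is a
-- scaling of the sum by zero.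
cut-trees-zero : ∀ {n} (B es : List (Edge n)) q → Flat B q → Flat es q → ∀ {a b} → q a ≢ q b → trees B es ≡ 0ℚ
cut-trees-zero B es q Bq esq qa≢qb = trans (trees-scale _ 0ℚ B B (λ s sq →
  trans (treeValue-zero (s ++ B) λ { (_ , span) → qa≢qb (span q (All.++⁺ sq Bq) _ _) })
        (sym (ℚ.*-zeroˡ (treeValue (s ++ B))))) es esq) (ℚ.*-zeroˡ (trees B es))

-- The induction for Kirchhoff's formula.

contract-value : ∀ r s t c N → s *ℚ c ≡ 1ℚ → (r + (- (t *ℚ c)) *ℚ t) *ℚ (s *ℚ N) ≡ (r *ℚ s - t *ℚ t) *ℚ N
contract-value r s t c N sc≡1 = begin
  -- Here `c` is the inverse of the pivot `s`, and the first factor is the Schur complement r -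
  -- t²/s. The pivot is the drop of an edge when that edge is contracted, and one plus that drop
  -- when it is added.
  (r + (- (t *ℚ c)) *ℚ t) *ℚ (s *ℚ N)
    ≡⟨ solve 5 (λ r s t c N → (r :+ (:- (t :* c)) :* t) :* (s :* N) := (r :* s :- t :* t :* (s :* c)) :* N) refl r s t c N ⟩
  (r *ℚ s - t *ℚ t *ℚ (s *ℚ c)) *ℚ N
    ≡⟨ cong (λ z → (r *ℚ s - t *ℚ t *ℚ z) *ℚ N) sc≡1 ⟩
  (r *ℚ s - t *ℚ t *ℚ 1ℚ) *ℚ N
    ≡⟨ cong (λ z → (r *ℚ s - z) *ℚ N) (ℚ.*-identityʳ (t *ℚ t)) ⟩
  (r *ℚ s - t *ℚ t) *ℚ N ∎
  where open ≡-Reasoning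

-- `Spans (B ++ es)` with the two lists kept apart, so that short-circuiting an edge only moves one
-- hypothesis.
Spans₂ : ∀ {n} → List (Edge n) → List (Edge n) → Set
Spans₂ {n} B es = ∀ w → Flat B w → Flat es w → ∀ (a b : Fin n) → w a ≡ w b

-- Existence of a potential and the tree count for its drop are bundled, since the same induction
-- produces both.
KirchhoffPotential : ∀ {n} → List (Edge n) → List (Edge n) → Edge n → Set
KirchhoffPotential B es f = ∃[ v ] Potential B es f v × δ f v *ℚ trees B es ≡ trees (f ∷ B) es

-- The trees through both `f` and `x` are given by the two-by-two determinant of drops. If `x` has
-- nonzero drop, contracting it replaces the drop r of `f` by r - t²/s, while the trees through `x`
-- number s times all trees.
minor-trees : ∀ {n} (B es : List (Edge n)) (f x : Edge n) v u →
  Potential B es f v → Potential B es x u →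
  δ x u *ℚ trees B es ≡ trees (x ∷ B) es → KirchhoffPotential (x ∷ B) es f →
  trees (f ∷ x ∷ B) es ≡ (δ f v *ℚ δ x u - δ x v *ℚ δ x v) *ℚ trees B es
minor-trees B es f x v u Pv Pu Nu (v₂ , Pv₂ , Nv₂) with δ x u ℚ.≟ 0ℚ
... | yes s≡0 = begin
  trees (f ∷ x ∷ B) es                                  ≡⟨ sym Nv₂ ⟩
  δ f v₂ *ℚ trees (x ∷ B) es                            ≡⟨ cong (δ f v₂ *ℚ_) (sym Nu) ⟩
  δ f v₂ *ℚ (δ x u *ℚ N)                                ≡⟨ cong (λ z → δ f v₂ *ℚ (z *ℚ N)) s≡0 ⟩
  δ f v₂ *ℚ (0ℚ *ℚ N)                                   ≡⟨ solve 3 (λ a r N → a :* (con 0ℚ :* N) := (r :* con 0ℚ :- con 0ℚ :* con 0ℚ) :* N) refl (δ f v₂) (δ f v) N ⟩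
  (δ f v *ℚ 0ℚ - 0ℚ *ℚ 0ℚ) *ℚ N                         ≡⟨ cong₂ (λ s t → (δ f v *ℚ s - t *ℚ t) *ℚ N) (sym s≡0) (sym t≡0) ⟩
  (δ f v *ℚ δ x u - δ x v *ℚ δ x v) *ℚ N                ∎
  where
  open ≡-Reasoning
  N = trees B es
  -- The energy of `u` is its drop along `x`, which is zero here, so `u` is flat on `es` and its
  -- mutual energy with `v` vanishes too.
  t≡0 : δ x v ≡ 0ℚ
  t≡0 = begin
    δ x v          ≡⟨ sym (proj₂ Pu v (proj₁ Pv)) ⟩
    energy es u v  ≡⟨ energy-sym es u v ⟩
    energy es v u  ≡⟨ energy-Flat v u (energy-zero⇒Flat es u (trans (proj₂ Pu u (proj₁ Pu)) s≡0)) ⟩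
    0ℚ             ∎
... | no s≢0 with inverse s≢0
...   | c , sc≡1 = begin
  trees (f ∷ x ∷ B) es                                             ≡⟨ sym Nv₂ ⟩
  -- The given `v₂` and the explicit `v₃` are potentials for the same current, so `reciprocity`
  -- identifies their drops along `f`.
  δ f v₂ *ℚ trees (x ∷ B) es                                       ≡⟨ cong₂ _*ℚ_ (reciprocity es v₂ v₃ Pv₂ Pv₃) (sym Nu) ⟩
  δ f v₃ *ℚ (δ x u *ℚ N)                                           ≡⟨ cong (_*ℚ (δ x u *ℚ N)) (trans (δ-axpy f v d u) (cong (λ z → δ f v + d *ℚ z) (reciprocity es u v Pu Pv))) ⟩
  (δ f v + (- (δ x v *ℚ c)) *ℚ δ x v) *ℚ (δ x u *ℚ N)              ≡⟨ contract-value (δ f v) (δ x u) (δ x v) c N sc≡1 ⟩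
  (δ f v *ℚ δ x u - δ x v *ℚ δ x v) *ℚ N                           ∎
  where
  open ≡-Reasoning
  N = trees B es
  d : ℚ
  -- Chosen to cancel the drop of `v` along `x`, as flatness on the contracted edge demands.
  d = - (δ x v *ℚ c)
  v₃ = axpy v d u
  x-flat : δ x v₃ ≡ 0ℚ
  x-flat = begin
    δ x v₃                                   ≡⟨ δ-axpy x v d u ⟩
    δ x v + (- (δ x v *ℚ c)) *ℚ δ x u        ≡⟨ solve 3 (λ t c s → t :+ (:- (t :* c)) :* s := t :- t :* (s :* c)) refl (δ x v) c (δ x u) ⟩
    δ x v - δ x v *ℚ (δ x u *ℚ c)            ≡⟨ cong (λ z → δ x v - δ x v *ℚ z) sc≡1 ⟩
    δ x v - δ x v *ℚ 1ℚ                      ≡⟨ solve 1 (λ t → t :- t :* con 1ℚ := con 0ℚ) refl (δ x v) ⟩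
    0ℚ                                       ∎
  Pv₃ : Potential (x ∷ B) es f v₃
  Pv₃ = x-flat ∷ Flat-axpy v d u (proj₁ Pv) (proj₁ Pu) , λ { w (wx ∷ wB) → begin
    energy es v₃ w                      ≡⟨ energy-axpy es v d u w ⟩
    energy es v w + d *ℚ energy es u w  ≡⟨ cong₂ (λ a b → a + d *ℚ b) (proj₂ Pv w wB) (trans (proj₂ Pu w wB) wx) ⟩
    δ f w + d *ℚ 0ℚ                     ≡⟨ solve 2 (λ a d → a :+ d :* con 0ℚ := a) refl (δ f w) d ⟩
    δ f w                               ∎ }

-- A rank-one update: the new edge adds a product of drops along `x` to the form, and the potential
-- of `f` is corrected by a multiple of the potential of `x`.
kirchhoff-add : ∀ {n} (B es : List (Edge n)) (f x : Edge n) →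
  KirchhoffPotential B es f → KirchhoffPotential B es x → KirchhoffPotential (x ∷ B) es f →
  KirchhoffPotential B (x ∷ es) f
kirchhoff-add B es f x (v , Pv , Nv) (u , Pu , Nu) K₂
  -- The drop of `u` along `x` is its own energy, hence nonnegative, which makes one plus it
  -- invertible.
  with inverse (one-plus-nonneg≢0 (subst (0ℚ ≤ℚ_) (proj₂ Pu u (proj₁ Pu)) (energy-nonneg es u)))
... | c , sc≡1 = v′ , (Flat-axpy v d u (proj₁ Pv) (proj₁ Pu) , solves) , counts
  where
  open ≡-Reasoning
  N = trees B es
  r s t d : ℚ
  r = δ f v
  s = δ x u
  t = δ x v
  d = - (t *ℚ c)
  v′ = axpy v d u
  solves : ∀ w → Flat B w → energy (x ∷ es) v′ w ≡ δ f w
  solves w wB = begin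
    δ x v′ *ℚ δ x w + energy es v′ w
      ≡⟨ cong₂ (λ a b → a *ℚ δ x w + b) (δ-axpy x v d u)
           (trans (energy-axpy es v d u w) (cong₂ (λ a b → a + d *ℚ b) (proj₂ Pv w wB) (proj₂ Pu w wB))) ⟩
    (t + d *ℚ s) *ℚ δ x w + (δ f w + d *ℚ δ x w)
      ≡⟨ solve 5 (λ t c s y z → (t :+ (:- (t :* c)) :* s) :* y :+ (z :+ (:- (t :* c)) :* y)
                   := z :+ t :* y :* (con 1ℚ :- (con 1ℚ :+ s) :* c)) refl t c s (δ x w) (δ f w) ⟩
    δ f w + t *ℚ δ x w *ℚ (1ℚ - (1ℚ + s) *ℚ c)
      ≡⟨ cong (λ z → δ f w + t *ℚ δ x w *ℚ z) (≡⇒diff≡0 (sym sc≡1)) ⟩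
    δ f w + t *ℚ δ x w *ℚ 0ℚ
      ≡⟨ solve 2 (λ a b → a :+ b :* con 0ℚ := a) refl (δ f w) (t *ℚ δ x w) ⟩
    δ f w ∎
  counts : δ f v′ *ℚ trees B (x ∷ es) ≡ trees (f ∷ B) (x ∷ es)
  counts = begin
    δ f v′ *ℚ (N + trees (x ∷ B) es)
      ≡⟨ cong₂ (λ a b → a *ℚ (N + b)) (trans (δ-axpy f v d u) (cong (λ z → r + d *ℚ z) (reciprocity es u v Pu Pv))) (sym Nu) ⟩
    (r + d *ℚ t) *ℚ (N + s *ℚ N)
      ≡⟨ cong ((r + d *ℚ t) *ℚ_) (solve 2 (λ s N → N :+ s :* N := (con 1ℚ :+ s) :* N) refl s N) ⟩
    (r + d *ℚ t) *ℚ ((1ℚ + s) *ℚ N)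
      ≡⟨ contract-value r (1ℚ + s) t c N sc≡1 ⟩
    (r *ℚ (1ℚ + s) - t *ℚ t) *ℚ N
      ≡⟨ solve 4 (λ r s t N → (r :* (con 1ℚ :+ s) :- t :* t) :* N := r :* N :+ (r :* s :- t :* t) :* N) refl r s t N ⟩
    r *ℚ N + (r *ℚ s - t *ℚ t) *ℚ N
      -- The two summands are the trees through `f` avoiding `x` and those containing both.
      ≡⟨ cong₂ _+_ Nv (trans (sym (minor-trees B es f x v u Pv Pu Nu K₂)) (trees-↭ (↭.swap f x ↭.refl) es)) ⟩
    trees (f ∷ B) es + trees (x ∷ f ∷ B) es ∎

-- The potential in the graph with `x` contracted is shifted on one side of the cut. The shift is
-- flat on `B` and `es`, so it only has to supply the current that the bridge carries.
kirchhoff-bridge : ∀ {n} (B es : List (Edge n)) (f x : Edge n) p →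
  Flat B (indicator p) → Flat es (indicator p) → δ x (indicator p) *ℚ δ x (indicator p) ≡ 1ℚ →
  KirchhoffPotential (x ∷ B) es f → KirchhoffPotential B (x ∷ es) f
kirchhoff-bridge B es f x p Bq esq xx (v , (vx ∷ vB , Ev) , Nv) =
  v′ , (Flat-axpy v g q vB Bq , solves) , counts
  where
  open ≡-Reasoning
  q = indicator p
  g h : ℚ
  g = δ f q
  h = δ x q
  v′ = axpy v g q
  -- The equation for `v` is available only against vectors flat along `x`; an arbitrary `w` is made
  -- so by a multiple of `q`, which the energy on `es` does not see.
  energy-v : ∀ w → Flat B w → energy es v w ≡ δ f w - δ x w *ℚ h *ℚ g
  energy-v w wB = begin
    energy es v w                          ≡⟨ solve 2 (λ a e → a := a :+ e :* con 0ℚ) refl (energy es v w) e ⟩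
    energy es v w + e *ℚ 0ℚ                ≡⟨ cong (λ z → energy es v w + e *ℚ z) (sym (energy-Flat v q esq)) ⟩
    energy es v w + e *ℚ energy es v q     ≡⟨ sym (energy-axpyʳ es v w e q) ⟩
    energy es v (axpy w e q)               ≡⟨ Ev (axpy w e q) (x-flat ∷ Flat-axpy w e q wB Bq) ⟩
    δ f (axpy w e q)                       ≡⟨ δ-axpy f w e q ⟩
    δ f w + e *ℚ g                         ≡⟨ solve 4 (λ a y h g → a :+ (:- (y :* h)) :* g := a :- y :* h :* g) refl (δ f w) (δ x w) h g ⟩
    δ f w - δ x w *ℚ h *ℚ g                ∎
    where
    e : ℚ
    e = - (δ x w *ℚ h)
    x-flat : δ x (axpy w e q) ≡ 0ℚ
    x-flat = begin
      δ x (axpy w e q)                   ≡⟨ δ-axpy x w e q ⟩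
      δ x w + (- (δ x w *ℚ h)) *ℚ h      ≡⟨ solve 2 (λ y h → y :+ (:- (y :* h)) :* h := y :- y :* (h :* h)) refl (δ x w) h ⟩
      δ x w - δ x w *ℚ (h *ℚ h)          ≡⟨ cong (λ z → δ x w - δ x w *ℚ z) xx ⟩
      δ x w - δ x w *ℚ 1ℚ                ≡⟨ solve 1 (λ y → y :- y :* con 1ℚ := con 0ℚ) refl (δ x w) ⟩
      0ℚ                                 ∎
  solves : ∀ w → Flat B w → energy (x ∷ es) v′ w ≡ δ f w
  solves w wB = begin
    δ x v′ *ℚ δ x w + energy es v′ w
      ≡⟨ cong₂ (λ a b → a *ℚ δ x w + b)
           (trans (δ-axpy x v g q) (cong (_+ g *ℚ h) vx))
           (trans (energy-axpy es v g q w) (cong₂ (λ a b → a + g *ℚ b) (energy-v w wB)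
             (trans (energy-sym es q w) (energy-Flat w q esq)))) ⟩
    (0ℚ + g *ℚ h) *ℚ δ x w + ((δ f w - δ x w *ℚ h *ℚ g) + g *ℚ 0ℚ)
      ≡⟨ solve 4 (λ g h y z → (con 0ℚ :+ g :* h) :* y :+ ((z :- y :* h :* g) :+ g :* con 0ℚ) := z) refl g h (δ x w) (δ f w) ⟩
    δ f w ∎
  N = trees (x ∷ B) es
  counts : δ f v′ *ℚ trees B (x ∷ es) ≡ trees (f ∷ B) (x ∷ es)
  counts = begin
    δ f v′ *ℚ (trees B es + N)
      -- Without the bridge there are no trees. Those through `f` avoiding `x` are matched below
      -- with those through `x` by exchange across the cut.
      ≡⟨ cong₂ (λ a b → a *ℚ (b + N)) (δ-axpy f v g q)
           (cut-trees-zero B es q Bq esq {proj₁ x} {proj₂ x} (λ eq → square-one⇒≢0 xx (≡⇒diff≡0 eq))) ⟩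
    (δ f v + g *ℚ g) *ℚ (0ℚ + N)
      ≡⟨ solve 3 (λ r g N → (r :+ g :* g) :* (con 0ℚ :+ N) := g :* g :* N :+ r :* N) refl (δ f v) g N ⟩
    g *ℚ g *ℚ N + δ f v *ℚ N
      ≡⟨ cong₂ _+_ (sym (cut-trees B es f x p Bq esq xx)) (trans Nv (trees-↭ (↭.swap f x ↭.refl) es)) ⟩
    trees (f ∷ B) es + trees (x ∷ f ∷ B) es ∎

-- Induction on `es` with `B` arbitrary, because each step also needs the contraction by `x`. At the
-- end `B` alone spans: the zero vector is a potential, and `f ∷ B` has too many edges for a tree.
kirchhoff : ∀ {n} (es B : List (Edge n)) (f : Edge n) → Spans₂ B es → KirchhoffPotential B es f
kirchhoff {n} [] B f span = (λ _ → 0ℚ) , (All.tabulate (λ _ → refl) , λ w wB → sym (≡⇒diff≡0 (span w wB [] _ _))) ,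
  trans (ℚ.*-zeroˡ (treeValue B)) (sym (treeValue-zero (f ∷ B) λ { (len , _) →
    ℕ.<-irrefl refl (subst (_≤ length B) (sym len) (spanning-length B (λ w wB → span w wB []))) }))
kirchhoff (x ∷ es) B f span with Spans-or-cut (B ++ es)
... | inj₁ span′ = kirchhoff-add B es f x (kirchhoff es B f span″) (kirchhoff es B x span″) (kirchhoff es (x ∷ B) f shorted)
  where
  span″ : Spans₂ B es
  span″ w wB wes = span′ w (All.++⁺ wB wes)
  shorted : Spans₂ (x ∷ B) es
  shorted w (wx ∷ wB) wes = span w wB (wx ∷ wes)
... | inj₂ (p , flat , a , b , pa≢pb) with δ-indicator p x
-- A cut that `x` does not cross would disconnect the whole graph.
...   | inj₁ x0 = ⊥-elim (pa≢pb (span (indicator p) (All.++⁻ˡ B flat) (x0 ∷ All.++⁻ʳ B flat) a b))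
...   | inj₂ xx = kirchhoff-bridge B es f x p (All.++⁻ˡ B flat) (All.++⁻ʳ B flat) xx
                    (kirchhoff es (x ∷ B) f λ { w (wx ∷ wB) wes → span w wB (wx ∷ wes) })

-- Counting spanning trees

treeValue-nonneg : ∀ {n} (s : List (Edge n)) → 0ℚ ≤ℚ treeValue s
treeValue-nonneg s with isSpanningTreeᵇ s
... | true  = ℚ.nonNegative⁻¹ 1ℚ
... | false = ℚ.≤-refl

trees-nonneg : ∀ {n} (B es : List (Edge n)) → 0ℚ ≤ℚ trees B es
trees-nonneg B []       = treeValue-nonneg B
trees-nonneg B (x ∷ es) = ℚ.+-mono-≤ (trees-nonneg B es) (trees-nonneg (x ∷ B) es)

treeValue-nonzero : ∀ {n} (s : List (Edge n)) → SpanningTree s → treeValue s ≢ 0ℚ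
treeValue-nonzero s st eq with isSpanningTreeᵇ s | ⇒isSpanningTreeᵇ s st
treeValue-nonzero s st () | true | _

-- Spanning forces `m` to be at most one, and the exact equation then fixes the number of edges; `m`
-- is zero only for the empty vertex set.
contraction-tree : ∀ {n} (m : ℕ) (B : List (Edge n)) → Contraction B m → m ℕ.+ length B ≡ n → Spans B → SpanningTree B
contraction-tree {zero}  zero B C eq span = eq , span
contraction-tree {suc n} zero B C eq span with Contraction.class C F.zero
... | ()
contraction-tree (suc zero) B C eq span = cong (_∸ 1) eq , span
contraction-tree (suc (suc m)) B C eq span with spanning-contraction span C F.zero (F.suc F.zero)
... | ()

-- B stays a forest throughout: it is contracted to exactly n - length B vertices.
trees-nonzero : ∀ {n} (es B : List (Edge n)) (m : ℕ) → Contraction B m → m ℕ.+ length B ≡ n →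
  Spans₂ B es → trees B es ≢ 0ℚ
trees-nonzero [] B m C eq span =
  treeValue-nonzero B (contraction-tree m B C eq (λ w wB → span w wB []))
trees-nonzero (x ∷ es) B m C eq span zero-sum with Spans-or-cut (B ++ es)
... | inj₁ span′ = trees-nonzero es B m C eq (λ w wB wes → span′ w (All.++⁺ wB wes))
        (proj₁ (nonneg-sum-zero (trees-nonneg B es) (trees-nonneg (x ∷ B) es) zero-sum))
trees-nonzero {n} (x ∷ es) B m C eq span zero-sum | inj₂ (p , flat , a , b , pa≢pb) = finish m C eq
  where
  separated : ∀ {m} (C : Contraction B m) → Contraction.class C (proj₁ x) ≢ Contraction.class C (proj₂ x)
  -- Were the ends of `x` in one class of `B`, the cut would be flat on `x` as well and would
  -- disconnect the graph.
  separated C c≡ = pa≢pb (span (indicator p) (All.++⁻ˡ B flat)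
    (≡⇒diff≡0 (Contraction.faithful C (indicator p) (All.++⁻ˡ B flat) _ _ c≡) ∷ All.++⁻ʳ B flat) a b)
  finish : ∀ m → Contraction B m → m ℕ.+ length B ≡ n → ⊥
  finish zero C eq with Contraction.class C (proj₁ x)
  ... | ()
  finish (suc m) C eq = trees-nonzero es (x ∷ B) m (contract-∷ C x (separated C))
    (trans (ℕ.+-suc m (length B)) eq) (λ { w (wx ∷ wB) wes → span w wB (wx ∷ wes) })
    (proj₂ (nonneg-sum-zero (trees-nonneg B es) (trees-nonneg (x ∷ B) es) zero-sum))

-- Natural-number counts inside the rationals.

ι : ℕ → ℚ
ι zero    = 0ℚ
ι (suc n) = 1ℚ + ι n

ι-nonneg : ∀ n → 0ℚ ≤ℚ ι n
ι-nonneg zero    = ℚ.≤-refl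
ι-nonneg (suc n) = ℚ.+-mono-≤ (ℚ.nonNegative⁻¹ 1ℚ) (ι-nonneg n)

ι-+ : ∀ m n → ι (m ℕ.+ n) ≡ ι m + ι n
ι-+ zero    n = sym (ℚ.+-identityˡ (ι n))
ι-+ (suc m) n = trans (cong (1ℚ +_) (ι-+ m n)) (sym (ℚ.+-assoc 1ℚ (ι m) (ι n)))

ι-* : ∀ m n → ι (m ℕ.* n) ≡ ι m *ℚ ι n
ι-* zero    n = sym (ℚ.*-zeroˡ (ι n))
ι-* (suc m) n = trans (ι-+ n (m ℕ.* n)) (trans (cong (ι n +_) (ι-* m n))
  (solve 2 (λ x y → y :+ x :* y := (con 1ℚ :+ x) :* y) refl (ι m) (ι n)))

ι-injective : ∀ m n → ι m ≡ ι n → m ≡ n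
ι-injective zero    zero    _  = refl
ι-injective zero    (suc n) eq = ⊥-elim (one-plus-nonneg≢0 (ι-nonneg n) (sym eq))
ι-injective (suc m) zero    eq = ⊥-elim (one-plus-nonneg≢0 (ι-nonneg m) eq)
ι-injective (suc m) (suc n) eq = cong suc (ι-injective m n (trans (cancel (ι m)) (trans (cong (_- 1ℚ) eq) (sym (cancel (ι n))))))
  where
  cancel : ∀ x → x ≡ (1ℚ + x) - 1ℚ
  cancel = solve 1 (λ x → x := (con 1ℚ :+ x) :- con 1ℚ) refl

countᵇ : ∀ {X : Set} → (X → Bool) → List X → ℕ
countᵇ p xs = length (filterᵇ p xs)

countᵇ-++ : ∀ {X : Set} (p : X → Bool) xs ys → countᵇ p (xs ++ ys) ≡ countᵇ p xs ℕ.+ countᵇ p ys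
countᵇ-++ p []       ys = refl
countᵇ-++ p (x ∷ xs) ys with p x
... | true  = cong suc (countᵇ-++ p xs ys)
... | false = countᵇ-++ p xs ys

countᵇ-map : ∀ {X Y : Set} (p : Y → Bool) (f : X → Y) xs → countᵇ p (map f xs) ≡ countᵇ (p ∘ f) xs
countᵇ-map p f []       = refl
countᵇ-map p f (x ∷ xs) with p (f x)
... | true  = cong suc (countᵇ-map p f xs)
... | false = countᵇ-map p f xs

countᵇ-cong : ∀ {X : Set} {p q : X → Bool} → (∀ x → p x ≡ q x) → ∀ xs → countᵇ p xs ≡ countᵇ q xs
countᵇ-cong         p≗q []       = refl
countᵇ-cong {p = p} {q} p≗q (x ∷ xs) with p x | q x | p≗q x
... | true  | _ | refl = cong suc (countᵇ-cong p≗q xs)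
... | false | _ | refl = countᵇ-cong p≗q xs

-- Each chosen edge is pushed onto `B`, so a sublist arrives there in reverse order; with `ʳ++` the
-- two recursions agree definitionally.
trees≡count : ∀ {n} (B es : List (Edge n)) →
  trees B es ≡ ι (countᵇ (λ s → isSpanningTreeᵇ (s ʳ++ B)) (sublists es))
trees≡count B [] with isSpanningTreeᵇ B
... | true  = refl
... | false = refl
trees≡count B (x ∷ es) = begin
  trees B es + trees (x ∷ B) es
    ≡⟨ cong₂ _+_ (trees≡count B es) (trees≡count (x ∷ B) es) ⟩
  ι (countᵇ p (sublists es)) + ι (countᵇ (p ∘ (x ∷_)) (sublists es))
    ≡⟨ cong (λ z → ι (countᵇ p (sublists es)) + ι z) (sym (countᵇ-map p (x ∷_) (sublists es))) ⟩
  ι (countᵇ p (sublists es)) + ι (countᵇ p (map (x ∷_) (sublists es)))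
    ≡⟨ sym (ι-+ (countᵇ p (sublists es)) _) ⟩
  ι (countᵇ p (sublists es) ℕ.+ countᵇ p (map (x ∷_) (sublists es)))
    ≡⟨ cong ι (sym (countᵇ-++ p (sublists es) _)) ⟩
  ι (countᵇ p (sublists (x ∷ es))) ∎
  where
  open ≡-Reasoning
  p : List _ → Bool
  p s = isSpanningTreeᵇ (s ʳ++ B)

trees≡τ : ∀ {n} (A : Adj n) → trees [] (edges A) ≡ ι (τ A)
trees≡τ A = trans (trees≡count [] (edges A)) (cong ι (countᵇ-cong reversed (sublists (edges A))))
  where
  reversed : ∀ s → isSpanningTreeᵇ (s ʳ++ []) ≡ isSpanningTreeᵇ s
  reversed s = T-ext _ _
    (⇒isSpanningTreeᵇ s ∘ SpanningTree-↭ (↭.↭-reverse s) ∘ isSpanningTreeᵇ⇒ _)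
    (⇒isSpanningTreeᵇ _ ∘ SpanningTree-↭ (↭-sym (↭.↭-reverse s)) ∘ isSpanningTreeᵇ⇒ s)

trees-↭ʳ : ∀ {n} (B : List (Edge n)) {es es′} → es ↭ es′ → trees B es ≡ trees B es′
trees-↭ʳ B ↭.refl         = refl
trees-↭ʳ B (↭.prep x p)   = cong₂ _+_ (trees-↭ʳ B p) (trees-↭ʳ (x ∷ B) p)
trees-↭ʳ B (↭.trans p q)  = trans (trees-↭ʳ B p) (trees-↭ʳ B q)
trees-↭ʳ B {x ∷ y ∷ es} {_ ∷ _ ∷ es′} (↭.swap x y p) = begin
  (trees B es + trees (y ∷ B) es) + (trees (x ∷ B) es + trees (y ∷ x ∷ B) es)
    ≡⟨ solve 4 (λ a b c d → (a :+ b) :+ (c :+ d) := (a :+ c) :+ (b :+ d)) refl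
         (trees B es) (trees (y ∷ B) es) (trees (x ∷ B) es) (trees (y ∷ x ∷ B) es) ⟩
  (trees B es + trees (x ∷ B) es) + (trees (y ∷ B) es + trees (y ∷ x ∷ B) es)
    ≡⟨ cong₂ _+_ (cong₂ _+_ (trees-↭ʳ B p) (trees-↭ʳ (x ∷ B) p))
         (cong₂ _+_ (trees-↭ʳ (y ∷ B) p) (trans (trees-↭ʳ (y ∷ x ∷ B) p) (trees-↭ (↭.swap y x ↭.refl) es′))) ⟩
  (trees B es′ + trees (x ∷ B) es′) + (trees (y ∷ B) es′ + trees (x ∷ y ∷ B) es′) ∎
  where open ≡-Reasoning

energy-↭ : ∀ {n} {es es′ : List (Edge n)} → es ↭ es′ → ∀ v w → energy es v w ≡ energy es′ v w
energy-↭ ↭.refl        v w = refl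
energy-↭ (↭.prep x p)  v w = cong (δ x v *ℚ δ x w +_) (energy-↭ p v w)
energy-↭ (↭.trans p q) v w = trans (energy-↭ p v w) (energy-↭ q v w)
energy-↭ {es = x ∷ y ∷ es} (↭.swap x y p) v w = trans
  (solve 3 (λ a b c → a :+ (b :+ c) := b :+ (a :+ c)) refl (δ x v *ℚ δ x w) (δ y v *ℚ δ y w) (energy es v w))
  (cong (λ z → δ y v *ℚ δ y w + (δ x v *ℚ δ x w + z)) (energy-↭ p v w))

-- Dropping one copy of a repeated edge keeps a set spanning, and from a tree this would leave too
-- few edges.
doubled-edge-trees : ∀ {n} (e : Edge n) (es : List (Edge n)) → trees (e ∷ e ∷ []) es ≡ 0ℚ
doubled-edge-trees {n} e es = trans (trees-scale (λ _ → ⊤) 0ℚ (e ∷ e ∷ []) [] (λ s _ →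
  trans (treeValue-zero (s ++ e ∷ e ∷ []) (not-tree s ∘ SpanningTree-↭ (↭.++-comm s (e ∷ e ∷ []))))
        (sym (ℚ.*-zeroˡ (treeValue (s ++ []))))) es (All.universal (λ _ → tt) es)) (ℚ.*-zeroˡ (trees [] es))
  where
  not-tree : ∀ s → ¬ SpanningTree (e ∷ e ∷ s)
  not-tree s (len , span) = ℕ.<-irrefl refl (subst (_≤ length (e ∷ s)) (sym len)
    (spanning-length (e ∷ s) λ { w (we ∷ ws) → span w (we ∷ we ∷ ws) }))

-- Edge lists of graphs

isEdgeᵇ : ∀ {n} → Adj n → Edge n → Bool
isEdgeᵇ A (a , b) = ⌊ a F.<? b ⌋ ∧ A a b

filterᵇ-map : ∀ {X Y : Set} (p : Y → Bool) (f : X → Y) xs → filterᵇ p (map f xs) ≡ map f (filterᵇ (p ∘ f) xs)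
filterᵇ-map p f []       = refl
filterᵇ-map p f (x ∷ xs) with p (f x)
... | true  = cong (f x ∷_) (filterᵇ-map p f xs)
... | false = filterᵇ-map p f xs

-- As one filter of a duplicate-free product list, the edge list admits removal of a single entry.
edges≡filter : ∀ {n} (A : Adj n) → edges A ≡ filterᵇ (isEdgeᵇ A) (cartesianProduct (allFin n) (allFin n))
edges≡filter {n} A = go (allFin n)
  where
  go : ∀ xs → concatMap (λ a → map (λ b → a , b) (filterᵇ (λ b → ⌊ a F.<? b ⌋ ∧ A a b) (allFin n))) xs
              ≡ filterᵇ (isEdgeᵇ A) (cartesianProduct xs (allFin n))
  go []       = refl
  go (a ∷ xs) = trans (cong₂ _++_ (sym (filterᵇ-map (isEdgeᵇ A) (a ,_) (allFin n))) (go xs))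
    (sym (List.filter-++ (Bool.T? ∘ isEdgeᵇ A) (map (a ,_) (allFin n)) _))

∈-edges : ∀ {n} (A : Adj n) a b → a F.< b → A a b ≡ true → (a , b) ∈ edges A
∈-edges A a b a<b Aab = subst ((a , b) ∈_) (sym (edges≡filter A))
  (∈-filter⁺ (Bool.T? ∘ isEdgeᵇ A) (∈-cartesianProduct⁺ (∈-allFin a) (∈-allFin b))
    (Equivalence.from T-∧ (fromWitness {a? = a F.<? b} a<b , Equivalence.from T-≡ Aab)))

Connected⇒Spans : ∀ {n} (A : Adj n) → IsSimple A → Connected A → Spans (edges A)
Connected⇒Spans A (A-sym , A-irr) conn w flat a b = along (conn a b)
  where
  adjacent : ∀ b c → A b c ≡ true → w b ≡ w c
  adjacent b c Abc with F.<-cmp b c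
  ... | tri< b<c _ _ = diff≡0⇒≡ (All.lookup flat (∈-edges A b c b<c Abc))
  ... | tri≈ _ b≡c _ = cong w b≡c
  ... | tri> _ _ c<b = sym (diff≡0⇒≡ (All.lookup flat (∈-edges A c b c<b (trans (A-sym c b) Abc))))
  along : ∀ {a b} → Reachable A a b → w a ≡ w b
  along here = refl
  along (step {b = b} {c} r Abc) = trans (along r) (adjacent b c Abc)

filterᵇ-cong : ∀ {X : Set} {p q : X → Bool} {xs} → All (λ x → p x ≡ q x) xs → filterᵇ p xs ≡ filterᵇ q xs
filterᵇ-cong [] = refl
filterᵇ-cong {p = p} {q} {x ∷ xs} (px≡qx ∷ eqs) with p x | q x
filterᵇ-cong {xs = x ∷ xs} (refl ∷ eqs) | true  | _ = cong (x ∷_) (filterᵇ-cong eqs)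
filterᵇ-cong (refl ∷ eqs) | false | _ = filterᵇ-cong eqs

filterᵇ-remove : ∀ {X : Set} (p q : X → Bool) (e : X) → p e ≡ true → q e ≡ false → (∀ x → x ≢ e → p x ≡ q x) →
  ∀ xs → Unique xs → e ∈ xs → filterᵇ p xs ↭ e ∷ filterᵇ q xs
filterᵇ-remove p q e pe qe agree (.e ∷ xs) (e∉ ∷ uniq) (here refl) rewrite pe | qe =
  ↭.prep e (↭.↭-reflexive (filterᵇ-cong (All.map (λ {x} e≢x → agree x (e≢x ∘ sym)) e∉)))
filterᵇ-remove p q e pe qe agree (x ∷ xs) (x∉ ∷ uniq) (there e∈xs)
  rewrite agree x (λ x≡e → All.lookup x∉ e∈xs x≡e) with q x
... | true  = ↭-trans (↭.prep x (filterᵇ-remove p q e pe qe agree xs uniq e∈xs)) (↭.swap x e ↭.refl)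
... | false = filterᵇ-remove p q e pe qe agree xs uniq e∈xs

deleteEdge-matches : ∀ {n} (A : Adj n) k l → deleteEdge A k l k l ≡ false × deleteEdge A k l l k ≡ false
deleteEdge-matches A k l rewrite ==-refl k | ==-refl l = ∧-zeroʳ (A k l) , trans (cong (λ z → A l k ∧ not z) (∨-zeroʳ (l == k ∧ k == l))) (∧-zeroʳ (A l k))

==-≢ : ∀ {n} {a b : Fin n} → a ≢ b → (a == b) ≡ false
==-≢ {a = a} {b} a≢b with a F.≟ b
... | yes a≡b = ⊥-elim (a≢b a≡b)
... | no _    = refl

deleteEdge-other : ∀ {n} (A : Adj n) k l a b → (a , b) ≢ (k , l) → (a , b) ≢ (l , k) → deleteEdge A k l a b ≡ A a b
deleteEdge-other A k l a b ab≢kl ab≢lk with a F.≟ k | b F.≟ l | a F.≟ l | b F.≟ k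
... | yes refl | yes refl | _ | _ = ⊥-elim (ab≢kl refl)
... | _ | _ | yes refl | yes refl = ⊥-elim (ab≢lk refl)
... | yes _ | no _  | yes _ | no _  = ∧-identityʳ (A a b)
... | yes _ | no _  | no _  | _     = ∧-identityʳ (A a b)
... | no _  | _     | yes _ | no _  = ∧-identityʳ (A a b)
... | no _  | _     | no _  | _     = ∧-identityʳ (A a b)

-- The list stores an edge with its smaller end first, whereas deletion may name the ends in either
-- order; `(a , b)` is the stored form.
edges-remove : ∀ {n} (A : Adj n) (k l a b : Fin n) → a F.< b → A a b ≡ true →
  ((a , b) ≡ (k , l) ⊎ (a , b) ≡ (l , k)) → edges A ↭ (a , b) ∷ edges (deleteEdge A k l)
edges-remove {n} A k l a b a<b Aab ab≡ = subst₂ (λ x y → x ↭ (a , b) ∷ y) (sym (edges≡filter A)) (sym (edges≡filter A′))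
  (filterᵇ-remove (isEdgeᵇ A) (isEdgeᵇ A′) (a , b) pe (qe ab≡) agree _
    (Unique.cartesianProduct⁺ (Unique.allFin⁺ n) (Unique.allFin⁺ n)) (∈-cartesianProduct⁺ (∈-allFin a) (∈-allFin b)))
  where
  A′ = deleteEdge A k l
  pe : isEdgeᵇ A (a , b) ≡ true
  pe = Equivalence.to T-≡ (Equivalence.from T-∧ (fromWitness {a? = a F.<? b} a<b , Equivalence.from T-≡ Aab))
  qe : ((a , b) ≡ (k , l) ⊎ (a , b) ≡ (l , k)) → isEdgeᵇ A′ (a , b) ≡ false
  qe (inj₁ refl) = trans (cong (⌊ a F.<? b ⌋ ∧_) (proj₁ (deleteEdge-matches A k l))) (∧-zeroʳ _)
  qe (inj₂ refl) = trans (cong (⌊ a F.<? b ⌋ ∧_) (proj₂ (deleteEdge-matches A k l))) (∧-zeroʳ _)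
  unoriented : ((a , b) ≡ (k , l) ⊎ (a , b) ≡ (l , k)) → ∀ c d → c F.< d → (c , d) ≢ (a , b) →
    (c , d) ≢ (k , l) × (c , d) ≢ (l , k)
  unoriented (inj₁ refl) c d c<d cd≢ab = cd≢ab , λ { refl → F.<-asym a<b c<d }
  unoriented (inj₂ refl) c d c<d cd≢ab = (λ { refl → F.<-asym a<b c<d }) , cd≢ab
  agree : ∀ e → e ≢ (a , b) → isEdgeᵇ A e ≡ isEdgeᵇ A′ e
  agree (c , d) cd≢ab with c F.<? d
  ... | no _ = refl
  ... | yes c<d with unoriented ab≡ c d c<d cd≢ab
  ...   | ≢kl , ≢lk = sym (deleteEdge-other A k l c d ≢kl ≢lk)

edges-delete : ∀ {n} (A : Adj n) → IsSimple A → ∀ k l → A k l ≡ true →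
  ∃[ e ] (e ≡ (k , l) ⊎ e ≡ (l , k)) × edges A ↭ e ∷ edges (deleteEdge A k l)
edges-delete A (A-sym , A-irr) k l Akl with F.<-cmp k l
... | tri< k<l _ _ = (k , l) , inj₁ refl , edges-remove A k l k l k<l Akl (inj₁ refl)
... | tri> _ _ l<k = (l , k) , inj₂ refl , edges-remove A k l l k l<k (trans (A-sym l k) Akl) (inj₂ refl)
... | tri≈ _ refl _ with trans (sym Akl) (A-irr k)
...   | ()

deleteEdge-simple : ∀ {n} (A : Adj n) → IsSimple A → ∀ k l → IsSimple (deleteEdge A k l)
deleteEdge-simple A (A-sym , A-irr) k l = (λ a b → cong₂ _∧_ (A-sym a b) (cong not
    (trans (∨-comm (a == k ∧ b == l) (a == l ∧ b == k)) (cong₂ _∨_ (∧-comm (a == l) (b == k)) (∧-comm (a == k) (b == l))))))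
  , λ a → cong (_∧ not ((a == k ∧ a == l) ∨ (a == l ∧ a == k))) (A-irr a)

-- The Laplacian as an energy form

sum-cong : ∀ {n} {f g : Fin n → ℚ} → (∀ a → f a ≡ g a) → sumℚ f ≡ sumℚ g
sum-cong {zero}  f≗g = refl
sum-cong {suc n} f≗g = cong₂ _+_ (f≗g F.zero) (sum-cong (f≗g ∘ F.suc))

sum-zero : ∀ n → sumℚ {n} (λ _ → 0ℚ) ≡ 0ℚ
sum-zero zero    = refl
sum-zero (suc n) = trans (ℚ.+-identityˡ (sumℚ {n} (λ _ → 0ℚ))) (sum-zero n)

sum-+ : ∀ {n} (f g : Fin n → ℚ) → sumℚ (λ a → f a + g a) ≡ sumℚ f + sumℚ g
sum-+ {zero}  f g = refl
sum-+ {suc n} f g = trans (cong (f F.zero + g F.zero +_) (sum-+ (f ∘ F.suc) (g ∘ F.suc)))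
  (solve 4 (λ a b c d → (a :+ b) :+ (c :+ d) := (a :+ c) :+ (b :+ d)) refl
    (f F.zero) (g F.zero) (sumℚ (f ∘ F.suc)) (sumℚ (g ∘ F.suc)))

sum-*ˡ : ∀ {n} c (f : Fin n → ℚ) → sumℚ (λ a → c *ℚ f a) ≡ c *ℚ sumℚ f
sum-*ˡ {zero}  c f = sym (ℚ.*-zeroʳ c)
sum-*ˡ {suc n} c f = trans (cong (c *ℚ f F.zero +_) (sum-*ˡ c (f ∘ F.suc)))
  (sym (ℚ.*-distribˡ-+ c (f F.zero) (sumℚ (f ∘ F.suc))))

sum-*ʳ : ∀ {n} (f : Fin n → ℚ) c → sumℚ (λ a → f a *ℚ c) ≡ sumℚ f *ℚ c
sum-*ʳ f c = trans (sum-cong (λ a → ℚ.*-comm (f a) c)) (trans (sum-*ˡ c f) (ℚ.*-comm c (sumℚ f)))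

sum-swap : ∀ {m n} (f : Fin m → Fin n → ℚ) → sumℚ (λ a → sumℚ (f a)) ≡ sumℚ (λ b → sumℚ (λ a → f a b))
sum-swap {zero}  {n} f = sym (sum-zero n)
sum-swap {suc m} f = trans (cong (sumℚ (f F.zero) +_) (sum-swap (f ∘ F.suc)))
  (sym (sum-+ (f F.zero) (λ b → sumℚ (λ a → f (F.suc a) b))))

sum-single : ∀ {n} (f : Fin n → ℚ) a → (∀ b → b ≢ a → f b ≡ 0ℚ) → sumℚ f ≡ f a
sum-single {suc n} f F.zero h = trans (cong (f F.zero +_)
  (trans (sum-cong (λ b → h (F.suc b) λ ())) (sum-zero n))) (ℚ.+-identityʳ (f F.zero))
sum-single {suc n} f (F.suc a) h = trans (cong₂ _+_ (h F.zero λ ())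
  (sum-single (f ∘ F.suc) a (λ b b≢a → h (F.suc b) (b≢a ∘ F.suc-injective)))) (ℚ.+-identityˡ (f (F.suc a)))

⊗-· : ∀ {n} (M N : Mat n) v a → ((M ⊗ N) · v) a ≡ (M · (N · v)) a
⊗-· M N v a = begin
  sumℚ (λ c → sumℚ (λ b → M a b *ℚ N b c) *ℚ v c)     ≡⟨ sum-cong (λ c → sym (sum-*ʳ (λ b → M a b *ℚ N b c) (v c))) ⟩
  sumℚ (λ c → sumℚ (λ b → M a b *ℚ N b c *ℚ v c))     ≡⟨ sum-swap (λ c b → M a b *ℚ N b c *ℚ v c) ⟩
  sumℚ (λ b → sumℚ (λ c → M a b *ℚ N b c *ℚ v c))     ≡⟨ sum-cong (λ b → sum-cong (λ c → ℚ.*-assoc (M a b) (N b c) (v c))) ⟩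
  sumℚ (λ b → sumℚ (λ c → M a b *ℚ (N b c *ℚ v c)))   ≡⟨ sum-cong (λ b → sum-*ˡ (M a b) (λ c → N b c *ℚ v c)) ⟩
  sumℚ (λ b → M a b *ℚ sumℚ (λ c → N b c *ℚ v c))     ∎
  where open ≡-Reasoning

·-congʳ : ∀ {n} (M : Mat n) {v w : Vec n} → (∀ a → v a ≡ w a) → ∀ a → (M · v) a ≡ (M · w) a
·-congʳ M v≗w a = sum-cong (λ b → cong (M a b *ℚ_) (v≗w b))

energy-++ : ∀ {n} (es es′ : List (Edge n)) v w → energy (es ++ es′) v w ≡ energy es v w + energy es′ v w
energy-++ []       es′ v w = sym (ℚ.+-identityˡ (energy es′ v w))
energy-++ (e ∷ es) es′ v w = trans (cong (δ e v *ℚ δ e w +_) (energy-++ es es′ v w))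
  (sym (ℚ.+-assoc (δ e v *ℚ δ e w) (energy es v w) (energy es′ v w)))

energy-concatMap : ∀ {m n} (g : Fin n → List (Edge n)) (h : Fin m → Fin n) v w →
  energy (concatMap g (tabulate h)) v w ≡ sumℚ (λ i → energy (g (h i)) v w)
energy-concatMap {zero}  g h v w = refl
energy-concatMap {suc m} g h v w = trans (energy-++ (g (h F.zero)) _ v w)
  (cong (energy (g (h F.zero)) v w +_) (energy-concatMap g (h ∘ F.suc) v w))

energy-row : ∀ {m n} (a : Fin n) (p : Fin n → Bool) (h : Fin m → Fin n) v w →
  energy (map (λ b → a , b) (filterᵇ p (tabulate h))) v w
    ≡ sumℚ (λ i → if p (h i) then δ (a , h i) v *ℚ δ (a , h i) w else 0ℚ)
energy-row {zero}  a p h v w = refl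
energy-row {suc m} a p h v w with p (h F.zero)
... | true  = cong (δ (a , h F.zero) v *ℚ δ (a , h F.zero) w +_) (energy-row a p (h ∘ F.suc) v w)
... | false = trans (energy-row a p (h ∘ F.suc) v w) (sym (ℚ.+-identityˡ _))

energy-edges : ∀ {n} (A : Adj n) v w → energy (edges A) v w ≡
  sumℚ (λ a → sumℚ (λ b → if ⌊ a F.<? b ⌋ ∧ A a b then δ (a , b) v *ℚ δ (a , b) w else 0ℚ))
energy-edges A v w = trans
  (energy-concatMap (λ a → map (λ b → a , b) (filterᵇ (λ b → ⌊ a F.<? b ⌋ ∧ A a b) (allFin _))) (λ a → a) v w)
  (sum-cong (λ a → energy-row a (λ b → ⌊ a F.<? b ⌋ ∧ A a b) (λ b → b) v w))

-- The degree is a sum over neighbours, so the diagonal term contributes one `v a` to each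
-- off-diagonal term.
laplacian-apply : ∀ {n} (A : Adj n) → IsSimple A → ∀ v a →
  (laplacian A · v) a ≡ sumℚ (λ b → if A a b then v a - v b else 0ℚ)
laplacian-apply A (_ , A-irr) v a = begin
  sumℚ (λ b → laplacian A a b *ℚ v b)
    ≡⟨ sum-cong split ⟩
  sumℚ (λ b → diagonal b + off b)
    ≡⟨ sum-+ diagonal off ⟩
  sumℚ diagonal + sumℚ off
    ≡⟨ cong (_+ sumℚ off) (trans (sum-single diagonal a (λ b b≢a → cong (if_then degree A a *ℚ v a else 0ℚ) (==-≢ (b≢a ∘ sym))))
         (cong (if_then degree A a *ℚ v a else 0ℚ) (==-refl a))) ⟩
  degree A a *ℚ v a + sumℚ off
    ≡⟨ cong (_+ sumℚ off) (sym (sum-*ʳ (λ b → if A a b then 1ℚ else 0ℚ) (v a))) ⟩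
  sumℚ (λ b → (if A a b then 1ℚ else 0ℚ) *ℚ v a) + sumℚ off
    ≡⟨ sym (sum-+ (λ b → (if A a b then 1ℚ else 0ℚ) *ℚ v a) off) ⟩
  sumℚ (λ b → (if A a b then 1ℚ else 0ℚ) *ℚ v a + off b)
    ≡⟨ sum-cong join ⟩
  sumℚ (λ b → if A a b then v a - v b else 0ℚ) ∎
  where
  open ≡-Reasoning
  diagonal off : _ → ℚ
  diagonal b = if a == b then degree A a *ℚ v a else 0ℚ
  off b = if A a b then - v b else 0ℚ
  split : ∀ b → laplacian A a b *ℚ v b ≡ diagonal b + off b
  split b with a F.≟ b
  ... | yes refl rewrite A-irr a = sym (ℚ.+-identityʳ (degree A a *ℚ v a))
  ... | no _ with A a b
  ...   | true  = solve 1 (λ x → (:- con 1ℚ) :* x := con 0ℚ :+ :- x) refl (v b)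
  ...   | false = solve 1 (λ x → con 0ℚ :* x := con 0ℚ :+ con 0ℚ) refl (v b)
  join : ∀ b → (if A a b then 1ℚ else 0ℚ) *ℚ v a + off b ≡ (if A a b then v a - v b else 0ℚ)
  join b with A a b
  ... | true  = solve 2 (λ x y → con 1ℚ :* x :+ :- y := x :- y) refl (v a) (v b)
  ... | false = solve 1 (λ x → con 0ℚ :* x :+ con 0ℚ := con 0ℚ) refl (v a)

-- Summation by parts: the sum over ordered pairs is split by the order of the two vertices, and
-- each pair in decreasing order is joined with its reversal.
laplacian-energy : ∀ {n} (A : Adj n) → IsSimple A → ∀ v w →
  sumℚ (λ a → w a *ℚ (laplacian A · v) a) ≡ energy (edges A) v w
laplacian-energy {n} A simple@(A-sym , A-irr) v w = begin
  sumℚ (λ a → w a *ℚ (laplacian A · v) a)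
    ≡⟨ sum-cong (λ a → trans (cong (w a *ℚ_) (laplacian-apply A simple v a))
         (sym (sum-*ˡ (w a) (λ b → if A a b then v a - v b else 0ℚ)))) ⟩
  sumℚ (λ a → sumℚ (t a))
    ≡⟨ sum-cong (λ a → trans (sum-cong (split a)) (sum-+ (up a) (down a))) ⟩
  sumℚ (λ a → sumℚ (up a) + sumℚ (down a))
    ≡⟨ sum-+ (λ a → sumℚ (up a)) (λ a → sumℚ (down a)) ⟩
  sumℚ (λ a → sumℚ (up a)) + sumℚ (λ a → sumℚ (down a))
    ≡⟨ cong (sumℚ (λ a → sumℚ (up a)) +_) (sum-swap down) ⟩
  sumℚ (λ a → sumℚ (up a)) + sumℚ (λ a → sumℚ (λ b → down b a))
    ≡⟨ sym (sum-+ (λ a → sumℚ (up a)) (λ a → sumℚ (λ b → down b a))) ⟩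
  sumℚ (λ a → sumℚ (up a) + sumℚ (λ b → down b a))
    ≡⟨ sum-cong (λ a → trans (sym (sum-+ (up a) (λ b → down b a))) (sum-cong (join a))) ⟩
  sumℚ (λ a → sumℚ (λ b → if ⌊ a F.<? b ⌋ ∧ A a b then δ (a , b) v *ℚ δ (a , b) w else 0ℚ))
    ≡⟨ sym (energy-edges A v w) ⟩
  energy (edges A) v w ∎
  where
  open ≡-Reasoning
  t up down : Fin n → Fin n → ℚ
  t a b = w a *ℚ (if A a b then v a - v b else 0ℚ)
  up a b = if ⌊ a F.<? b ⌋ then t a b else 0ℚ
  down a b = if ⌊ b F.<? a ⌋ then t a b else 0ℚ
  split : ∀ a b → t a b ≡ up a b + down a b
  split a b with a F.<? b | b F.<? a
  ... | yes a<b | yes b<a = ⊥-elim (F.<-asym a<b b<a)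
  ... | yes _ | no _ = sym (ℚ.+-identityʳ (t a b))
  ... | no _ | yes _ = sym (ℚ.+-identityˡ (t a b))
  ... | no a≮b | no b≮a with F.<-cmp a b
  ...   | tri< a<b _ _ = ⊥-elim (a≮b a<b)
  ...   | tri> _ _ b<a = ⊥-elim (b≮a b<a)
  ...   | tri≈ _ refl _ rewrite A-irr a = ℚ.*-zeroʳ (w a)
  join : ∀ a b → up a b + down b a ≡ (if ⌊ a F.<? b ⌋ ∧ A a b then δ (a , b) v *ℚ δ (a , b) w else 0ℚ)
  join a b rewrite A-sym b a with a F.<? b
  ... | no _ = refl
  ... | yes _ with A a b
  ...   | true = solve 4 (λ va vb wa wb → wa :* (va :- vb) :+ wb :* (vb :- va) := (va :- vb) :* (wa :- wb)) refl (v a) (v b) (w a) (w b)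
  ...   | false = solve 2 (λ wa wb → wa :* con 0ℚ :+ wb :* con 0ℚ := con 0ℚ) refl (w a) (w b)

-- Generalized inverses, potentials and resistances.

incidence-sum : ∀ {n} {k l : Fin n} → k ≢ l → ∀ (f : Vec n) → sumℚ (λ a → f a *ℚ incidence k l a) ≡ f k - f l
incidence-sum {k = k} {l} k≢l f = begin
  sumℚ (λ a → f a *ℚ incidence k l a)           ≡⟨ sum-cong split ⟩
  sumℚ (λ a → at k a (f a) + at l a (- f a))    ≡⟨ sum-+ (λ a → at k a (f a)) (λ a → at l a (- f a)) ⟩
  sumℚ (λ a → at k a (f a)) + sumℚ (λ a → at l a (- f a))
    ≡⟨ cong₂ _+_ (pick k f) (pick l (λ a → - f a)) ⟩
  f k - f l ∎
  where
  open ≡-Reasoning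
  at : ∀ {n} → Fin n → Fin n → ℚ → ℚ
  at k a x = if a == k then x else 0ℚ
  pick : ∀ {n} k (f : Vec n) → sumℚ (λ a → at k a (f a)) ≡ f k
  pick k f = trans (sum-single (λ a → at k a (f a)) k (λ b b≢k → cong (if_then f b else 0ℚ) (==-≢ b≢k)))
                   (cong (if_then f k else 0ℚ) (==-refl k))
  split : ∀ a → f a *ℚ incidence k l a ≡ at k a (f a) + at l a (- f a)
  split a with a F.≟ k | a F.≟ l
  ... | yes refl | yes refl = ⊥-elim (k≢l refl)
  ... | yes _ | no _  = solve 1 (λ x → x :* con 1ℚ := x :+ con 0ℚ) refl (f a)
  ... | no _  | yes _ = solve 1 (λ x → x :* (:- con 1ℚ) := con 0ℚ :+ :- x) refl (f a)
  ... | no _  | no _  = solve 1 (λ x → x :* con 0ℚ := con 0ℚ :+ con 0ℚ) refl (f a)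

unit : ∀ {n} → Fin n → Vec n
unit a b = if b == a then 1ℚ else 0ℚ

unit-sum : ∀ {n} (a : Fin n) (g : Vec n) → sumℚ (λ b → unit a b *ℚ g b) ≡ g a
unit-sum a g = trans (sum-single (λ b → unit a b *ℚ g b) a
    (λ b b≢a → trans (cong (λ z → (if z then 1ℚ else 0ℚ) *ℚ g b) (==-≢ b≢a)) (ℚ.*-zeroˡ (g b))))
  (trans (cong (λ z → (if z then 1ℚ else 0ℚ) *ℚ g a) (==-refl a)) (ℚ.*-identityˡ (g a)))

-- Testing the energy equation against unit vectors reads off the coordinates.
laplacian-Potential : ∀ {n} (A : Adj n) → IsSimple A → ∀ {k l} → k ≢ l → ∀ v →
  Potential [] (edges A) (k , l) v → ∀ a → (laplacian A · v) a ≡ incidence k l a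
laplacian-Potential A simple {k} {l} k≢l v (_ , Ev) a = begin
  (laplacian A · v) a                               ≡⟨ sym (unit-sum a (laplacian A · v)) ⟩
  sumℚ (λ b → unit a b *ℚ (laplacian A · v) b)      ≡⟨ laplacian-energy A simple v (unit a) ⟩
  energy (edges A) v (unit a)                       ≡⟨ Ev (unit a) [] ⟩
  unit a k - unit a l                               ≡⟨ sym (incidence-sum k≢l (unit a)) ⟩
  sumℚ (λ b → unit a b *ℚ incidence k l b)          ≡⟨ unit-sum a (incidence k l) ⟩
  incidence k l a                                   ∎
  where open ≡-Reasoning

Connected⇒Spans₂ : ∀ {n} (A : Adj n) → IsSimple A → Connected A → Spans₂ [] (edges A)
Connected⇒Spans₂ A simple conn w _ = Connected⇒Spans A simple conn w

-- Kirchhoff's formula supplies a vector `p` whose image under L is the incidence vector x. Hence L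
-- X x = L X L p = L p = x for every generalized inverse X, and pairing with `w` gives the energy
-- equation.
genInverse-Potential : ∀ {n} (A : Adj n) → IsSimple A → Connected A → ∀ {k l} → k ≢ l →
  ∀ X → IsGenInverse (laplacian A) X → Potential [] (edges A) (k , l) (X · incidence k l)
genInverse-Potential A simple conn {k} {l} k≢l X gen
  with kirchhoff (edges A) [] (k , l) (Connected⇒Spans₂ A simple conn)
... | p , Pp , _ = [] , λ w _ → begin
  energy (edges A) y w                           ≡⟨ sym (laplacian-energy A simple y w) ⟩
  sumℚ (λ a → w a *ℚ (laplacian A · y) a)        ≡⟨ sum-cong (λ a → cong (w a *ℚ_) (Ly a)) ⟩
  sumℚ (λ a → w a *ℚ incidence k l a)            ≡⟨ incidence-sum k≢l w ⟩
  w k - w l                                      ∎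
  where
  open ≡-Reasoning
  L = laplacian A
  y = X · incidence k l
  Lp : ∀ a → (L · p) a ≡ incidence k l a
  Lp = laplacian-Potential A simple k≢l p Pp
  Ly : ∀ a → (L · y) a ≡ incidence k l a
  Ly a = begin
    (L · (X · incidence k l)) a    ≡⟨ ·-congʳ L (·-congʳ X (λ b → sym (Lp b))) a ⟩
    (L · (X · (L · p))) a          ≡⟨ sym (⊗-· L X (L · p) a) ⟩
    ((L ⊗ X) · (L · p)) a          ≡⟨ sym (⊗-· (L ⊗ X) L p a) ⟩
    (((L ⊗ X) ⊗ L) · p) a          ≡⟨ sum-cong (λ b → cong (_*ℚ p b) (gen a b)) ⟩
    (L · p) a                      ≡⟨ Lp a ⟩
    incidence k l a                ∎

resistance≡δ : ∀ {n} (X : Mat n) {k l} → k ≢ l → resistance X k l ≡ δ (k , l) (X · incidence k l)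
resistance≡δ X {k} {l} k≢l = trans
  (solve 4 (λ a b c d → ((a :+ b) :- c) :- d := (a :- c) :- (d :- b)) refl (X k k) (X l l) (X k l) (X l k))
  (sym (cong₂ _-_ (incidence-sum k≢l (X k)) (incidence-sum k≢l (X l))))

adjacent⇒≢ : ∀ {n} (A : Adj n) → IsSimple A → ∀ {k l} → A k l ≡ true → k ≢ l
adjacent⇒≢ A (_ , A-irr) {k} Akl refl with trans (sym Akl) (A-irr k)
... | ()

τ-nonzero : ∀ {n} (A : Adj n) → IsSimple A → Connected A → ι (τ A) ≢ 0ℚ
τ-nonzero {n} A simple conn τ≡0 = trees-nonzero (edges A) [] n (contract-[] n) (ℕ.+-identityʳ n)
  (Connected⇒Spans₂ A simple conn) (trans (trees≡τ A) τ≡0)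

-- The resistance across an edge is the proportion of spanning trees containing it; the remaining
-- trees are those of the graph without the edge.
τ-delete : ∀ {n} (A : Adj n) → IsSimple A → Connected A → ∀ {k l} → A k l ≡ true →
  ∀ X → IsGenInverse (laplacian A) X → ι (τ (deleteEdge A k l)) ≡ (1ℚ - resistance X k l) *ℚ ι (τ A)
τ-delete A simple conn {k} {l} Akl X gen with edges-delete A simple k l Akl
... | e , e≡ , es↭ = begin
  ι (τ A′)                                ≡⟨ solve 2 (λ a b → a := (a :+ b) :- b) refl (ι (τ A′)) τₑ ⟩
  (ι (τ A′) + τₑ) - τₑ                      ≡⟨ cong₂ _-_ (sym total) (sym through-e) ⟩
  ι (τ A) - resistance X k l *ℚ ι (τ A)   ≡⟨ solve 2 (λ a r → a :- r :* a := (con 1ℚ :- r) :* a) refl (ι (τ A)) (resistance X k l) ⟩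
  (1ℚ - resistance X k l) *ℚ ι (τ A)      ∎
  where
  open ≡-Reasoning
  A′ = deleteEdge A k l
  es′ = edges A′
  τₑ = trees (e ∷ []) es′
  k≢l : k ≢ l
  k≢l = adjacent⇒≢ A simple Akl
  total : ι (τ A) ≡ ι (τ A′) + τₑ
  total = trans (sym (trees≡τ A)) (trans (trees-↭ʳ [] es↭) (cong (_+ τₑ) (trees≡τ A′)))
  through : ∀ a b → a ≢ b → resistance X a b *ℚ ι (τ A) ≡ trees ((a , b) ∷ []) (edges A)
  through a b a≢b with kirchhoff (edges A) [] (a , b) (Connected⇒Spans₂ A simple conn)
  ... | p , Pp , Np = begin
    resistance X a b *ℚ ι (τ A)
      ≡⟨ cong₂ _*ℚ_ (trans (resistance≡δ X a≢b) (reciprocity (edges A) (X · incidence a b) p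
           (genInverse-Potential A simple conn a≢b X gen) Pp)) (sym (trees≡τ A)) ⟩
    δ (a , b) p *ℚ trees [] (edges A)
      ≡⟨ Np ⟩
    trees ((a , b) ∷ []) (edges A) ∎
  through-unoriented : (e ≡ (k , l) ⊎ e ≡ (l , k)) → resistance X k l *ℚ ι (τ A) ≡ trees (e ∷ []) (edges A)
  through-unoriented (inj₁ refl) = through k l k≢l
  through-unoriented (inj₂ refl) = trans (cong (_*ℚ ι (τ A))
    (solve 4 (λ a b c d → ((a :+ b) :- c) :- d := ((b :+ a) :- d) :- c) refl (X k k) (X l l) (X k l) (X l k)))
    (through l k (k≢l ∘ sym))
  through-e : resistance X k l *ℚ ι (τ A) ≡ τₑ
  -- Kirchhoff's formula short-circuits `e` while `e` is still listed among the edges; the trees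
  -- that take it twice contribute zero.
  through-e = trans (through-unoriented e≡) (trans (trees-↭ʳ (e ∷ []) es↭)
    (trans (cong (τₑ +_) (doubled-edge-trees e es′)) (ℚ.+-identityʳ τₑ)))

energy-delete : ∀ {n} (A : Adj n) → IsSimple A → ∀ {k l} → A k l ≡ true → ∀ v w →
  energy (edges A) v w ≡ δ (k , l) v *ℚ δ (k , l) w + energy (edges (deleteEdge A k l)) v w
energy-delete A simple {k} {l} Akl v w with edges-delete A simple k l Akl
... | _ , inj₁ refl , es↭ = energy-↭ es↭ v w
... | _ , inj₂ refl , es↭ = trans (energy-↭ es↭ v w) (cong (_+ energy (edges (deleteEdge A k l)) v w)
  (solve 4 (λ a b c d → (b :- a) :* (d :- c) := (a :- b) :* (c :- d)) refl (v k) (v l) (w k) (w l)))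

-- Deleting an edge

-- The energy of the pair `v`, `u` on `es` is computed twice: from `v` being a potential on `es`,
-- and from `u` being one on `es′`.
delete-identity : ∀ {n} (es es′ : List (Edge n)) (f g : Edge n) →
  (∀ v w → energy es v w ≡ δ f v *ℚ δ f w + energy es′ v w) → ∀ v u h →
  Potential [] es g v → Potential [] es′ h u → δ g u ≡ δ f v *ℚ δ f u + δ h v
delete-identity es es′ f g split v u h (_ , Ev) (_ , Eu) = begin
  δ g u                              ≡⟨ sym (Ev u []) ⟩
  energy es v u                      ≡⟨ split v u ⟩
  δ f v *ℚ δ f u + energy es′ v u    ≡⟨ cong (δ f v *ℚ δ f u +_) (trans (energy-sym es′ v u) (Eu v [])) ⟩
  δ f v *ℚ δ f u + δ h v             ∎
  where open ≡-Reasoning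

-- With r and s the drops along `f` before and after deletion, the identity reads s = r s + r, which
-- is impossible for r = 1. The potential `u` on `es′` expresses that current can bypass `f`.
delete-factor≢0 : ∀ {n} (es es′ : List (Edge n)) (f : Edge n) →
  (∀ v w → energy es v w ≡ δ f v *ℚ δ f w + energy es′ v w) → ∀ p u →
  Potential [] es f p → Potential [] es′ f u → 1ℚ - δ f p ≢ 0ℚ
delete-factor≢0 es es′ f split p u P U 1-r≡0 = absurd (begin
  1ℚ                                ≡⟨ solve 1 (λ s → con 1ℚ := (con 1ℚ :* s :+ con 1ℚ) :- s) refl s ⟩
  (1ℚ *ℚ s + 1ℚ) - s                ≡⟨ cong (λ r → (r *ℚ s + r) - s) (diff≡0⇒≡ {1ℚ} {δ f p} 1-r≡0) ⟩
  (δ f p *ℚ s + δ f p) - s          ≡⟨ ≡⇒diff≡0 (sym (delete-identity es es′ f f split p u f P U)) ⟩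
  0ℚ                                ∎)
  where
  open ≡-Reasoning
  s : ℚ
  s = δ f u
  absurd : 1ℚ ≢ 0ℚ
  absurd ()

delete-coupling : ∀ {n} (es es′ : List (Edge n)) (f g : Edge n) →
  (∀ v w → energy es v w ≡ δ f v *ℚ δ f w + energy es′ v w) → ∀ p uf ug →
  Potential [] es f p → Potential [] es′ f uf → Potential [] es′ g ug →
  δ g p ≡ (1ℚ - δ f p) *ℚ δ g uf
delete-coupling es es′ f g split p uf ug P Uf Ug = begin
  δ g p                                              ≡⟨ solve 2 (λ a b → a := (b :+ a) :- b) refl (δ g p) (δ f p *ℚ δ f ug) ⟩
  (δ f p *ℚ δ f ug + δ g p) - δ f p *ℚ δ f ug        ≡⟨ cong (_- δ f p *ℚ δ f ug) (sym (delete-identity es es′ f f split p ug g P Ug)) ⟩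
  δ f ug - δ f p *ℚ δ f ug                           ≡⟨ solve 2 (λ r t → t :- r :* t := (con 1ℚ :- r) :* t) refl (δ f p) (δ f ug) ⟩
  (1ℚ - δ f p) *ℚ δ f ug                             ≡⟨ cong ((1ℚ - δ f p) *ℚ_) (sym (reciprocity es′ uf ug Uf Ug)) ⟩
  (1ℚ - δ f p) *ℚ δ g uf                             ∎
  where open ≡-Reasoning

zero-iff : ∀ {x y c} → x ≡ c *ℚ y → c ≢ 0ℚ → (y ≡ 0ℚ) ⇔ (x ≡ 0ℚ)
zero-iff {x} {y} {c} x≡cy c≢0 = mk⇔
  (λ y≡0 → trans x≡cy (trans (cong (c *ℚ_) y≡0) (ℚ.*-zeroʳ c)))
  (λ x≡0 → *-zero-factor c y (trans (sym x≡cy) x≡0) c≢0)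

δ-zero-iff : ∀ {n} (a b : Fin n) (w : Vec n) → (w a ≡ w b) ⇔ (δ (a , b) w ≡ 0ℚ)
δ-zero-iff a b w = mk⇔ ≡⇒diff≡0 diff≡0⇒≡

-- Let t and t′ be the mutual drops before and after deleting f, and r the resistance of f. Then t =
-- (1 - r) t′ with a nonzero factor, and the resistance of e increases by t t′, so every listed
-- statement says that t vanishes.
deletion-equivalents : ∀ {n} (A : Adj n) → IsSimple A → ∀ {k l i j : Fin n} → A k l ≡ true → i ≢ j →
  Connected A → Connected (deleteEdge A k l) → ∀ (X Y : Mat n) →
  IsGenInverse (laplacian A) X → IsGenInverse (laplacian (deleteEdge A k l)) Y →
  let xf = incidence k l in
  All (_⇔ (δ (i , j) (X · xf) ≡ 0ℚ))
    ( (resistance X i j ≡ resistance Y i j)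
    ∷ ((X · xf) i ≡ (X · xf) j)
    ∷ (∀ (Z : Mat n) → IsGenInverse (laplacian A) Z → (Z · xf) i ≡ (Z · xf) j)
    ∷ ((Y · xf) i ≡ (Y · xf) j)
    ∷ (∀ (Z : Mat n) → IsGenInverse (laplacian (deleteEdge A k l)) Z → (Z · xf) i ≡ (Z · xf) j)
    ∷ [])
deletion-equivalents {n} A simple {k} {l} {i} {j} Akl i≢j conn conn′ X Y genX genY =
    mk⇔ (λ r≡ → square-zero-coupling (trans (sym resX) (trans r≡ resY)))
        (λ t≡0 → trans resX (trans (equal-resistance t≡0) (sym resY)))
  ∷ δ-zero-iff i j (X · xf)
  ∷ mk⇔ (λ all → ≡⇒diff≡0 (all X genX)) (λ t≡0 Z genZ → diff≡0⇒≡ (trans (independent Z genZ) t≡0))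
  ∷ (coupled ⇔-∘ δ-zero-iff i j (Y · xf))
  ∷ (coupled ⇔-∘ mk⇔ (λ all → ≡⇒diff≡0 (all Y genY)) (λ t≡0 Z genZ → diff≡0⇒≡ (trans (independent′ Z genZ) t≡0)))
  ∷ []
  where
  open ≡-Reasoning
  A′ = deleteEdge A k l
  simple′ = deleteEdge-simple A simple k l
  xf = incidence k l
  xe = incidence i j
  e f : Edge n
  e = i , j
  f = k , l
  es = edges A
  es′ = edges A′
  k≢l = adjacent⇒≢ A simple Akl
  split = energy-delete A simple Akl
  potential : ∀ {a b} → a ≢ b → ∀ Z → IsGenInverse (laplacian A) Z → Potential [] es (a , b) (Z · incidence a b)
  potential = genInverse-Potential A simple conn
  potential′ : ∀ {a b} → a ≢ b → ∀ Z → IsGenInverse (laplacian A′) Z → Potential [] es′ (a , b) (Z · incidence a b)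
  potential′ = genInverse-Potential A′ simple′ conn′
  Pe = potential i≢j X genX
  Pf = potential k≢l X genX
  Ue = potential′ i≢j Y genY
  Uf = potential′ k≢l Y genY
  resX : resistance X i j ≡ δ e (X · xe)
  resX = resistance≡δ X i≢j
  resY : resistance Y i j ≡ δ e (Y · xe)
  resY = resistance≡δ Y i≢j
  coupling : δ e (X · xf) ≡ (1ℚ - δ f (X · xf)) *ℚ δ e (Y · xf)
  coupling = delete-coupling es es′ f e split (X · xf) (Y · xf) (Y · xe) Pf Uf Ue
  coupled : (δ e (Y · xf) ≡ 0ℚ) ⇔ (δ e (X · xf) ≡ 0ℚ)
  coupled = zero-iff coupling (delete-factor≢0 es es′ f split (X · xf) (Y · xf) Pf Uf)
  resistance-change : δ e (Y · xe) ≡ δ e (X · xf) *ℚ δ e (Y · xf) + δ e (X · xe)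
  resistance-change = trans (delete-identity es es′ f e split (X · xe) (Y · xe) e Pe Ue)
    (cong₂ (λ a b → a *ℚ b + δ e (X · xe)) (reciprocity es (X · xe) (X · xf) Pe Pf) (reciprocity es′ (Y · xe) (Y · xf) Ue Uf))
  equal-resistance : δ e (X · xf) ≡ 0ℚ → δ e (X · xe) ≡ δ e (Y · xe)
  equal-resistance t≡0 = sym (begin
    δ e (Y · xe)                                     ≡⟨ resistance-change ⟩
    δ e (X · xf) *ℚ δ e (Y · xf) + δ e (X · xe)      ≡⟨ cong (λ z → z *ℚ δ e (Y · xf) + δ e (X · xe)) t≡0 ⟩
    0ℚ *ℚ δ e (Y · xf) + δ e (X · xe)                ≡⟨ solve 2 (λ a b → con 0ℚ :* a :+ b := b) refl (δ e (Y · xf)) (δ e (X · xe)) ⟩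
    δ e (X · xe)                                     ∎)
  square-zero-coupling : δ e (X · xe) ≡ δ e (Y · xe) → δ e (X · xf) ≡ 0ℚ
  square-zero-coupling r≡ with δ e (X · xf) ℚ.≟ 0ℚ
  ... | yes t≡0 = t≡0
  -- Equal resistances make the product of the two mutual drops zero; a nonzero first factor kills
  -- the second, and the coupling then kills the first.
  ... | no t≢0 = Equivalence.to coupled (*-zero-factor (δ e (X · xf)) (δ e (Y · xf)) (begin
    δ e (X · xf) *ℚ δ e (Y · xf)
      ≡⟨ solve 2 (λ a b → a := (a :+ b) :- b) refl (δ e (X · xf) *ℚ δ e (Y · xf)) (δ e (X · xe)) ⟩
    (δ e (X · xf) *ℚ δ e (Y · xf) + δ e (X · xe)) - δ e (X · xe)
      ≡⟨ ≡⇒diff≡0 (trans (sym resistance-change) (sym r≡)) ⟩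
    0ℚ ∎) t≢0)
  -- Passing through the potential of `e` by `reciprocity` and back removes the dependence on the
  -- generalized inverse.
  independent : ∀ Z → IsGenInverse (laplacian A) Z → δ e (Z · xf) ≡ δ e (X · xf)
  independent Z genZ = trans (reciprocity es (Z · xf) (X · xe) (potential k≢l Z genZ) Pe)
                             (reciprocity es (X · xe) (X · xf) Pe Pf)
  independent′ : ∀ Z → IsGenInverse (laplacian A′) Z → δ e (Z · xf) ≡ δ e (Y · xf)
  independent′ Z genZ = trans (reciprocity es′ (Z · xf) (Y · xe) (potential′ k≢l Z genZ) Ue)
                              (reciprocity es′ (Y · xe) (Y · xf) Ue Uf)

-- The spanning-tree criterion and the assembly of the equivalences.

deleteEdge-Connected : ∀ {n} (A : Adj n) k l → Connected (deleteEdge A k l) → Connected A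
deleteEdge-Connected A k l conn a b = lift (conn a b)
  where
  lift : ∀ {a b} → Reachable (deleteEdge A k l) a b → Reachable A a b
  lift here = here
  lift (step {b = b} {c} r bc) = step (lift r)
    (Equivalence.to T-≡ (proj₁ (Equivalence.to (T-∧ {A b c}) (Equivalence.from T-≡ bc))))

-- Deleting the edge kl from G and from G without ij turns the two products into τ(G) τ(G without
-- ij) times 1 - r and 1 - r′. The common factor is nonzero, so equality of the products means r =
-- r′.
tree-equivalent : ∀ {n} (A : Adj n) → IsSimple A → ∀ {i j k l : Fin n} →
  A k l ≡ true → deleteEdge A i j k l ≡ true → Connected A → Connected (deleteEdge A i j) → ∀ (X Y : Mat n) →
  IsGenInverse (laplacian A) X → IsGenInverse (laplacian (deleteEdge A i j)) Y →
  (τ (deleteEdge A i j) ℕ.* τ (deleteEdge A k l) ≡ τ A ℕ.* τ (deleteEdge (deleteEdge A i j) k l))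
    ⇔ (resistance X k l ≡ resistance Y k l)
tree-equivalent A simple {i} {j} {k} {l} Akl A′kl conn conn′ X Y genX genY = mk⇔ to from
  where
  open ≡-Reasoning
  A′ = deleteEdge A i j
  simple′ = deleteEdge-simple A simple i j
  r r′ a b : ℚ
  r = resistance X k l
  r′ = resistance Y k l
  a = ι (τ A)
  b = ι (τ A′)
  left : ι (τ A′ ℕ.* τ (deleteEdge A k l)) ≡ a *ℚ b *ℚ (1ℚ - r)
  left = begin
    ι (τ A′ ℕ.* τ (deleteEdge A k l))     ≡⟨ ι-* (τ A′) (τ (deleteEdge A k l)) ⟩
    b *ℚ ι (τ (deleteEdge A k l))         ≡⟨ cong (b *ℚ_) (τ-delete A simple conn Akl X genX) ⟩
    b *ℚ ((1ℚ - r) *ℚ a)                  ≡⟨ solve 3 (λ a b c → b :* (c :* a) := a :* b :* c) refl a b (1ℚ - r) ⟩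
    a *ℚ b *ℚ (1ℚ - r)                    ∎
  right : ι (τ A ℕ.* τ (deleteEdge A′ k l)) ≡ a *ℚ b *ℚ (1ℚ - r′)
  right = begin
    ι (τ A ℕ.* τ (deleteEdge A′ k l))     ≡⟨ ι-* (τ A) (τ (deleteEdge A′ k l)) ⟩
    a *ℚ ι (τ (deleteEdge A′ k l))        ≡⟨ cong (a *ℚ_) (τ-delete A′ simple′ conn′ A′kl Y genY) ⟩
    a *ℚ ((1ℚ - r′) *ℚ b)                 ≡⟨ solve 3 (λ a b c → a :* (c :* b) := a :* b :* c) refl a b (1ℚ - r′) ⟩
    a *ℚ b *ℚ (1ℚ - r′)                   ∎
  from : r ≡ r′ → τ A′ ℕ.* τ (deleteEdge A k l) ≡ τ A ℕ.* τ (deleteEdge A′ k l)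
  from r≡r′ = ι-injective _ _ (trans left (trans (cong (λ z → a *ℚ b *ℚ (1ℚ - z)) r≡r′) (sym right)))
  to : τ A′ ℕ.* τ (deleteEdge A k l) ≡ τ A ℕ.* τ (deleteEdge A′ k l) → r ≡ r′
  to eq = sym (diff≡0⇒≡ (*-zero-factor b (r′ - r) (*-zero-factor a (b *ℚ (r′ - r)) (begin
    a *ℚ (b *ℚ (r′ - r))
      ≡⟨ solve 4 (λ a b r r′ → a :* (b :* (r′ :- r)) := a :* b :* (con 1ℚ :- r) :- a :* b :* (con 1ℚ :- r′)) refl a b r r′ ⟩
    a *ℚ b *ℚ (1ℚ - r) - a *ℚ b *ℚ (1ℚ - r′)
      ≡⟨ ≡⇒diff≡0 (trans (sym left) (trans (cong ι eq) right)) ⟩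
    0ℚ ∎) (τ-nonzero A simple conn)) (τ-nonzero A′ simple′ conn′)))

All-⇔⇒TFAE : ∀ {Z : Set} {ps : List Set} → All (_⇔ Z) ps → TFAE ps
All-⇔⇒TFAE all p∈ps q∈ps = ⇔-sym (All.lookup all q∈ps) ⇔-∘ All.lookup all p∈ps

-- Interleaves the statements obtained by deleting f with those obtained by deleting e; the tree
-- identity `P₃` enters through the resistance statement `P₂`.
merge-equivalents : ∀ {Z Z′ P₁ P₂ P₃ P₄ P₅ P₆ P₇ P₈ P₉ P₁₀ P₁₁ : Set} → Z′ ⇔ Z → P₃ ⇔ P₂ →
  All (_⇔ Z) (P₁ ∷ P₄ ∷ P₅ ∷ P₆ ∷ P₇ ∷ []) → All (_⇔ Z′) (P₂ ∷ P₈ ∷ P₉ ∷ P₁₀ ∷ P₁₁ ∷ []) →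
  All (_⇔ Z) (P₁ ∷ P₂ ∷ P₃ ∷ P₄ ∷ P₅ ∷ P₆ ∷ P₇ ∷ P₈ ∷ P₉ ∷ P₁₀ ∷ P₁₁ ∷ [])
merge-equivalents Z′⇔Z P₃⇔P₂ (p₁ ∷ p₄ ∷ p₅ ∷ p₆ ∷ p₇ ∷ []) (p₂ ∷ p₈ ∷ p₉ ∷ p₁₀ ∷ p₁₁ ∷ []) =
  p₁ ∷ (Z′⇔Z ⇔-∘ p₂) ∷ (Z′⇔Z ⇔-∘ (p₂ ⇔-∘ P₃⇔P₂)) ∷ p₄ ∷ p₅ ∷ p₆ ∷ p₇
     ∷ (Z′⇔Z ⇔-∘ p₈) ∷ (Z′⇔Z ⇔-∘ p₉) ∷ (Z′⇔Z ⇔-∘ p₁₀) ∷ (Z′⇔Z ⇔-∘ p₁₁) ∷ []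

theorem7p1 : (n : ℕ) → n ≥ 4 → (A : Adj n) → IsSimple A →
    (i j k l : Fin n) → A i j ≡ true → A k l ≡ true →
    i ≢ k → i ≢ l → j ≢ k → j ≢ l →
    Connected (deleteEdge A i j) → Connected (deleteEdge A k l) →
    (L⁺ Le⁺ Lf⁺ : Mat n) →
    IsMoorePenrose (laplacian A) L⁺ →
    IsMoorePenrose (laplacian (deleteEdge A i j)) Le⁺ →
    IsMoorePenrose (laplacian (deleteEdge A k l)) Lf⁺ →
    let L = laplacian A
        Le = laplacian (deleteEdge A i j)
        Lf = laplacian (deleteEdge A k l)
        xe = incidence i j
        xf = incidence k l
    in TFAE
      ( (resistance L⁺ i j ≡ resistance Lf⁺ i j)
      ∷ (resistance L⁺ k l ≡ resistance Le⁺ k l)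
      ∷ (τ (deleteEdge A i j) * τ (deleteEdge A k l) ≡ τ A * τ (deleteEdge (deleteEdge A i j) k l))
      ∷ ((L⁺ · xf) i ≡ (L⁺ · xf) j)
      ∷ (∀ (X : Mat n) → IsGenInverse L X → (X · xf) i ≡ (X · xf) j)
      ∷ ((Lf⁺ · xf) i ≡ (Lf⁺ · xf) j)
      ∷ (∀ (X : Mat n) → IsGenInverse Lf X → (X · xf) i ≡ (X · xf) j)
      ∷ ((L⁺ · xe) k ≡ (L⁺ · xe) l)
      ∷ (∀ (X : Mat n) → IsGenInverse L X → (X · xe) k ≡ (X · xe) l)
      ∷ ((Le⁺ · xe) k ≡ (Le⁺ · xe) l)
      ∷ (∀ (X : Mat n) → IsGenInverse Le X → (X · xe) k ≡ (X · xe) l)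
      ∷ [])
theorem7p1 n _ A simple i j k l Aij Akl i≢k _ j≢k _ conne connf L⁺ Le⁺ Lf⁺ (gen , _) (gene , _) (genf , _) =
  All-⇔⇒TFAE (merge-equivalents Z′⇔Z iii⇔ii
    -- The same list is used twice with the roles of the two edges interchanged; `Z′⇔Z` matches the
    -- two mutual drops by `reciprocity`.
    (deletion-equivalents A simple Akl i≢j conn connf L⁺ Lf⁺ gen genf)
    (deletion-equivalents A simple Aij k≢l conn conne L⁺ Le⁺ gen gene))
  where
  conn : Connected A
  conn = deleteEdge-Connected A i j conne
  i≢j : i ≢ j
  i≢j = adjacent⇒≢ A simple Aij
  k≢l : k ≢ l
  k≢l = adjacent⇒≢ A simple Akl
  symmetric : δ (k , l) (L⁺ · incidence i j) ≡ δ (i , j) (L⁺ · incidence k l)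
  symmetric = reciprocity (edges A) (L⁺ · incidence i j) (L⁺ · incidence k l)
    (genInverse-Potential A simple conn i≢j L⁺ gen) (genInverse-Potential A simple conn k≢l L⁺ gen)
  Z′⇔Z : (δ (k , l) (L⁺ · incidence i j) ≡ 0ℚ) ⇔ (δ (i , j) (L⁺ · incidence k l) ≡ 0ℚ)
  Z′⇔Z = mk⇔ (trans (sym symmetric)) (trans symmetric)
  iii⇔ii : (τ (deleteEdge A i j) * τ (deleteEdge A k l) ≡ τ A * τ (deleteEdge (deleteEdge A i j) k l))
    ⇔ (resistance L⁺ k l ≡ resistance Le⁺ k l)
  iii⇔ii = tree-equivalent A simple Akl
    -- The edge kl survives the deletion of ij, because `k` differs from both `i` and `j`.
    (trans (deleteEdge-other A i j k l (λ eq → i≢k (sym (cong proj₁ eq))) (λ eq → j≢k (sym (cong proj₁ eq)))) Akl)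
    conn conne L⁺ Le⁺ gen gene
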